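{- For all positive integers $n$, $m$, and $h$ with $m\leq n$, we have $$\rho_{\pm}(\mathbb{Z}_n,m,h)=\rho(\mathbb{Z}_n,m,h).$$
   Context: $\mathbb{Z}_n$ is the cyclic group of order $n$, written additively. For an $m$-subset $A=\{a_1,\dots,a_m\}$ of a finite abelian group $G$ (with $m\ge 1$), the $h$-fold sumset and $h$-fold signed sumset are $$hA=\Big\{ \sum_{i=1}^m \lambda_i a_i : (\lambda_1,\dots,\lambda_m)\in\mathbb{N}_0^m,\ \sum_{i=1}^m\lambda_i=h\Big\},$$ $$h_{\pm}A=\Big\{ \sum_{i=1}^m \lambda_i a_i : (\lambda_1,\dots,\lambda_m)\in\mathbb{Z}^m,\ \sum_{i=1}^m|\lambda_i|=h\Big\},$$ where $\mathbb{N}_0$ is the set of nonnegative integers. For a positive integer $m\le|G|$, $$\rho(G,m,h)=\min\{|hA| : A\subseteq G,\ |A|=m\},\qquad \rho_{\pm}(G,m,h)=\min\{|h_{\pm}A| : A\subseteq G,\ |A|=m\}.$$ -}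

module Defs where

open import Algebra.Bundles using (AbelianGroup)
open import Algebra.Definitions.RawMonoid using (sum)
open import Algebra.Structures using (IsAbelianGroup)
open import Data.Fin.Base using (Fin; zero; suc; toℕ)
open import Data.Fin.Properties using (_≟_; any?; toℕ-fromℕ<; toℕ-injective; toℕ<n)
open import Data.Fin.Subset using (Subset; inside; ⊥; ∣_∣)
open import Data.Fin.Subset.Properties using (_∈?_; ∣⊥∣≡0; anySubset?)
open import Data.Integer.Base as ℤ using (ℤ; +_; -[1+_])
open import Data.List.Base using (List; allFin; filter; length; lookup; map; upTo; _++_)
open import Data.List.Membership.Propositional using (_∈_; find; lose)
open import Data.List.Membership.Propositional.Properties
  using (∈-map⁺; ∈-++⁺ˡ; ∈-++⁺ʳ; ∈-upTo⁺)
import Data.List.Relation.Unary.Any as Any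
open import Data.Nat.Base as ℕ
  using (ℕ; zero; suc; NonZero; _≤_; _<_; z≤n; s≤s; _∸_; _%_; +-0-rawMonoid)
import Data.Nat.Properties as ℕ
open import Data.Nat.DivMod
  using (_mod_; m%n<n; m<n⇒m%n≡m; %-distribˡ-+; m%n%n≡m%n; n%n≡0)
open import Data.Nat.Induction using (<-rec)
open import Data.Product.Base using (∃; ∃-syntax; Σ-syntax; _×_; _,_; proj₁)
open import Data.Vec.Base as Vec using (_∷_)
open import Data.Vec.Functional as Vector using (Vector)
open import Function.Base using (_∘_)
open import Level using (0ℓ)
open import Relation.Binary.PropositionalEquality
open import Relation.Nullary.Decidable using (Dec; yes; no; does; map′; _×-dec_)

------------------------------------------------------------------------
-- Finite abelian groups

-- Up to isomorphism, every abelian group of order n has carrier Fin n.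

record FiniteAbelianGroup (n : ℕ) : Set where
  infixl 6 _+_
  infix  8 -_
  field
    _+_            : Fin n → Fin n → Fin n
    0#             : Fin n
    -_             : Fin n → Fin n
    isAbelianGroup : IsAbelianGroup _≡_ _+_ 0# -_

  abelianGroup : AbelianGroup 0ℓ 0ℓ
  abelianGroup = record { isAbelianGroup = isAbelianGroup }

  open AbelianGroup abelianGroup public using (rawMonoid)
  open import Algebra.Definitions.RawMonoid rawMonoid public
    using () renaming (_×_ to infixr 8 _·ℕ_; sum to ∑)

  infixr 8 _·ℤ_
  _·ℤ_ : ℤ → Fin n → Fin n
  (+ k)    ·ℤ x = k ·ℕ x
  -[1+ k ] ·ℤ x = - (suc k ·ℕ x)

------------------------------------------------------------------------
-- Cyclic groups

module _ (n : ℕ) .{{_ : NonZero n}} where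

  private
    _⊕_ : Fin n → Fin n → Fin n
    i ⊕ j = (toℕ i ℕ.+ toℕ j) mod n

    𝟎 : Fin n
    𝟎 = 0 mod n

    ⊖_ : Fin n → Fin n
    ⊖ i = (n ∸ toℕ i) mod n

    toℕ-mod : ∀ k → toℕ (k mod n) ≡ k % n
    toℕ-mod k = toℕ-fromℕ< (m%n<n k n)

    mod-toℕ : ∀ i → toℕ i % n ≡ toℕ i
    mod-toℕ i = m<n⇒m%n≡m (toℕ<n i)

    [k%n+l]%n : ∀ k l → (k % n ℕ.+ l) % n ≡ (k ℕ.+ l) % n
    [k%n+l]%n k l = begin
      (k % n ℕ.+ l) % n              ≡⟨ %-distribˡ-+ (k % n) l n ⟩
      (k % n % n ℕ.+ l % n) % n      ≡⟨ cong (λ z → (z ℕ.+ l % n) % n) (m%n%n≡m%n k n) ⟩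
      (k % n ℕ.+ l % n) % n          ≡⟨ %-distribˡ-+ k l n ⟨
      (k ℕ.+ l) % n                  ∎
      where open ≡-Reasoning

    mod-⊕ : ∀ k j → (k mod n) ⊕ j ≡ (k ℕ.+ toℕ j) mod n
    mod-⊕ k j = toℕ-injective (begin
      toℕ ((k mod n) ⊕ j)               ≡⟨ toℕ-mod _ ⟩
      (toℕ (k mod n) ℕ.+ toℕ j) % n     ≡⟨ cong (λ z → (z ℕ.+ toℕ j) % n) (toℕ-mod k) ⟩
      (k % n ℕ.+ toℕ j) % n             ≡⟨ [k%n+l]%n k (toℕ j) ⟩
      (k ℕ.+ toℕ j) % n                 ≡⟨ toℕ-mod _ ⟨
      toℕ ((k ℕ.+ toℕ j) mod n)         ∎)
      where open ≡-Reasoning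

    ⊕-comm : ∀ i j → i ⊕ j ≡ j ⊕ i
    ⊕-comm i j = cong (_mod n) (ℕ.+-comm (toℕ i) (toℕ j))

    ⊕-assoc : ∀ i j k → (i ⊕ j) ⊕ k ≡ i ⊕ (j ⊕ k)
    ⊕-assoc i j k = begin
      (i ⊕ j) ⊕ k                              ≡⟨ mod-⊕ _ k ⟩
      (toℕ i ℕ.+ toℕ j ℕ.+ toℕ k) mod n        ≡⟨ cong (_mod n) (ℕ.+-assoc (toℕ i) _ _) ⟩
      (toℕ i ℕ.+ (toℕ j ℕ.+ toℕ k)) mod n      ≡⟨ cong (_mod n) (ℕ.+-comm (toℕ i) _) ⟩
      (toℕ j ℕ.+ toℕ k ℕ.+ toℕ i) mod n        ≡⟨ mod-⊕ _ i ⟨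
      (j ⊕ k) ⊕ i                              ≡⟨ ⊕-comm (j ⊕ k) i ⟩
      i ⊕ (j ⊕ k)                              ∎
      where open ≡-Reasoning

    ⊕-identityˡ : ∀ i → 𝟎 ⊕ i ≡ i
    ⊕-identityˡ i = trans (mod-⊕ 0 i) (toℕ-injective (trans (toℕ-mod _) (mod-toℕ i)))

    ⊕-inverseˡ : ∀ i → (⊖ i) ⊕ i ≡ 𝟎
    ⊕-inverseˡ i = toℕ-injective (begin
      toℕ ((⊖ i) ⊕ i)                        ≡⟨ cong toℕ (mod-⊕ _ i) ⟩
      toℕ ((n ∸ toℕ i ℕ.+ toℕ i) mod n)      ≡⟨ toℕ-mod _ ⟩
      (n ∸ toℕ i ℕ.+ toℕ i) % n              ≡⟨ cong (_% n) (ℕ.m∸n+n≡m (ℕ.<⇒≤ (toℕ<n i))) ⟩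
      n % n                                  ≡⟨ n%n≡0 n ⟩
      0                                      ≡⟨ m<n⇒m%n≡m (ℕ.>-nonZero⁻¹ n) ⟨
      0 % n                                  ≡⟨ toℕ-mod 0 ⟨
      toℕ 𝟎                                  ∎)
      where open ≡-Reasoning

  ℤ/_ : FiniteAbelianGroup n
  ℤ/_ = record
    { _+_ = _⊕_
    ; 0#  = 𝟎
    ; -_  = ⊖_
    ; isAbelianGroup = record
      { isGroup = record
        { isMonoid = record
          { isSemigroup = record
            { isMagma = record { isEquivalence = isEquivalence ; ∙-cong = cong₂ _⊕_ }
            ; assoc   = ⊕-assoc
            }
          ; identity = ⊕-identityˡ , λ i → trans (⊕-comm i 𝟎) (⊕-identityˡ i)
          }
        ; inverse = ⊕-inverseˡ , λ i → trans (⊕-comm i (⊖ i)) (⊕-inverseˡ i)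
        ; ⁻¹-cong = cong ⊖_
        }
      ; comm = ⊕-comm
      }
    }

------------------------------------------------------------------------
-- Sumsets and signed sumsets

elements : ∀ {n} → Subset n → List (Fin n)
elements {n} A = filter (_∈? A) (allFin n)

module _ {n : ℕ} (G : FiniteAbelianGroup n) where

  open FiniteAbelianGroup G

  module _ (h : ℕ) {m : ℕ} (a : Vector (Fin n) m) (x : Fin n) where

    IsSum : Set
    IsSum = Σ[ c ∈ Vector ℕ m ] sum +-0-rawMonoid c ≡ h × ∑ (λ i → c i ·ℕ a i) ≡ x

    IsSignedSum : Set
    IsSignedSum = Σ[ c ∈ Vector ℤ m ]
      sum +-0-rawMonoid (λ i → ℤ.∣ c i ∣) ≡ h × ∑ (λ i → c i ·ℤ a i) ≡ x

  private
    module Search {C : Set} (w : C → ℕ) (_·_ : C → Fin n → Fin n)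
      (ball : ℕ → List C) (∈-ball : ∀ {h} c → w c ≤ h → c ∈ ball h) where

      Combination : ∀ h {m} → Vector (Fin n) m → Fin n → Set
      Combination h {m} a x = Σ[ c ∈ Vector C m ]
        sum +-0-rawMonoid (λ i → w (c i)) ≡ h × ∑ (λ i → c i · a i) ≡ x

      combination? : ∀ h {m} (a : Vector (Fin n) m) x → Dec (Combination h a x)
      combination? h {zero}  a x =
        map′ (λ (p , q) → (λ ()) , p , q) (λ (_ , p , q) → p , q)
             (0 ℕ.≟ h ×-dec 0# ≟ x)
      combination? h {suc m} a x = map′ to from (Any.any? first? (ball h))
        where
        First : C → Set
        First c₀ = w c₀ ℕ.+ (h ∸ w c₀) ≡ h ×
          ∃[ y ] Combination (h ∸ w c₀) (Vector.tail a) y × (c₀ · a zero) + y ≡ x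

        first? : ∀ c₀ → Dec (First c₀)
        first? c₀ = (_ ℕ.≟ h) ×-dec
          any? (λ y → combination? (h ∸ w c₀) (Vector.tail a) y ×-dec (_ ≟ x))

        to : Any.Any First (ball h) → Combination h a x
        to any with find any
        ... | c₀ , _ , p , y , (c , q , r) , s =
          (c₀ Vector.∷ c) , trans (cong (w c₀ ℕ.+_) q) p , trans (cong (λ z → (c₀ · a zero) + z) r) s

        from : Combination h a x → Any.Any First (ball h)
        from (c , refl , q) = lose (∈-ball (c zero) (ℕ.m≤m+n _ _))
          ( cong (w (c zero) ℕ.+_) (ℕ.m+n∸m≡n (w (c zero)) _)
          , _ , (Vector.tail c , sym (ℕ.m+n∸m≡n (w (c zero)) _) , refl) , q )

    ∈-ballℤ : ∀ {h} c → ℤ.∣ c ∣ ≤ h → c ∈ map +_ (upTo (suc h)) ++ map -[1+_] (upTo h)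
    ∈-ballℤ (+ k)      k≤h = ∈-++⁺ˡ (∈-map⁺ +_ (∈-upTo⁺ (s≤s k≤h)))
    ∈-ballℤ {h} -[1+ k ] k<h = ∈-++⁺ʳ (map +_ (upTo (suc h))) (∈-map⁺ -[1+_] (∈-upTo⁺ k<h))

  isSum? : ∀ h {m} (a : Vector (Fin n) m) x → Dec (IsSum h a x)
  isSum? = Search.combination? (λ k → k) _·ℕ_ (λ h → upTo (suc h)) (λ _ k≤h → ∈-upTo⁺ (s≤s k≤h))

  isSignedSum? : ∀ h {m} (a : Vector (Fin n) m) x → Dec (IsSignedSum h a x)
  isSignedSum? = Search.combination? ℤ.∣_∣ _·ℤ_ _ ∈-ballℤ

  sumset : ℕ → Subset n → Subset n
  sumset h A = Vec.tabulate (λ x → does (isSum? h (lookup (elements A)) x))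

  signedSumset : ℕ → Subset n → Subset n
  signedSumset h A = Vec.tabulate (λ x → does (isSignedSum? h (lookup (elements A)) x))

------------------------------------------------------------------------
-- Minimum sizes

IsMinimumOverSubsets : ∀ {n} (m : ℕ) → (Subset n → ℕ) → ℕ → Set
IsMinimumOverSubsets m f k =
  (∃[ A ] ∣ A ∣ ≡ m × f A ≡ k) × (∀ A → ∣ A ∣ ≡ m → k ≤ f A)

private
  subsetOfSize : ∀ {m n} → m ≤ n → Σ[ A ∈ Subset n ] ∣ A ∣ ≡ m
  subsetOfSize {n = n} z≤n = ⊥ , ∣⊥∣≡0 n
  subsetOfSize (s≤s m≤n) with A , ∣A∣≡m ← subsetOfSize m≤n = inside ∷ A , cong suc ∣A∣≡m

minimumOverSubsets : ∀ {m n} → m ≤ n → (f : Subset n → ℕ) → ∃ (IsMinimumOverSubsets m f)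
minimumOverSubsets {m} {n} m≤n f with A , ∣A∣≡m ← subsetOfSize m≤n =
  <-rec (λ k → ∀ A → ∣ A ∣ ≡ m → f A ≡ k → ∃ (IsMinimumOverSubsets m f)) descend _ A ∣A∣≡m refl
  where
  descend : ∀ k → (∀ {j} → j < k → ∀ A → ∣ A ∣ ≡ m → f A ≡ j → ∃ (IsMinimumOverSubsets m f)) →
            ∀ A → ∣ A ∣ ≡ m → f A ≡ k → ∃ (IsMinimumOverSubsets m f)
  descend k rec A ∣A∣≡m fA≡k with anySubset? (λ B → ∣ B ∣ ℕ.≟ m ×-dec f B ℕ.<? k)
  ... | yes (B , ∣B∣≡m , fB<k) = rec fB<k B ∣B∣≡m refl
  ... | no  ∄B = k , (A , ∣A∣≡m , fA≡k) , λ B ∣B∣≡m → ℕ.≮⇒≥ (λ fB<k → ∄B (B , ∣B∣≡m , fB<k))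

module _ {n : ℕ} (G : FiniteAbelianGroup n) (m h : ℕ) (m≤n : m ≤ n) where

  ρ : ℕ
  ρ = proj₁ (minimumOverSubsets m≤n (λ A → ∣ sumset G h A ∣))

  ρ± : ℕ
  ρ± = proj₁ (minimumOverSubsets m≤n (λ A → ∣ signedSumset G h A ∣))

{-# OPTIONS --safe #-}
-- The sumset hA lies in the signed sumset, so only ρ± ≤ ρ needs work. Kneser's
-- theorem, applied along the chain of sums A, 2A, …, hA with S the stabilizer of hA
-- and d = |S|, gives |hA| ≥ (hb + 1)d where A is covered by b + 1 cosets of S and
-- b + 1 ≤ k = n/d. Conversely let H be the subgroup of order d. A set C of b + 1 cosets
-- of H in arithmetic progression satisfies |hC| ≤ (hb + 1)d, and if C = −C then hC
-- contains the signed h-fold sumset of every subset of C. Such a C exists with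
-- difference 1 if b is even and with difference 2 if k is odd. If b is odd and k is
-- even, then (b, d, k) can be replaced by ((b − 1)/2, 2d, k/2), which covers as many
-- elements and does not increase (hb + 1)d.

module Submission where

open import Defs
open import Algebra.Bundles using (AbelianGroup)
open import Algebra.Definitions.RawMonoid using (sum)
import Algebra.Properties.AbelianGroup as AbelianGroupProperties
import Algebra.Properties.CommutativeMonoid.Mult as CommutativeMonoidMult
import Algebra.Properties.Monoid.Mult as MonoidMult
open import Data.Fin.Base using (Fin; zero; suc; toℕ)
open import Data.Fin.Properties
  using (_≟_; any?; all?; suc-injective; 0≢1+n; toℕ-fromℕ<; toℕ-injective; toℕ<n)
open import Data.Fin.Subset
open import Data.Fin.Subset.Properties
open import Data.Integer.Base as ℤ using (ℤ; -[1+_])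
open import Data.List.Base using (lookup; allFin)
open import Data.List.Membership.Propositional.Properties
  using (∈-allFin; ∈-filter⁺; ∈-filter⁻; ∈-lookup)
open import Data.List.Relation.Unary.Any using (index)
open import Data.List.Relation.Unary.Any.Properties using (lookup-index)
open import Data.Nat.Base as ℕ using (ℕ; zero; suc; NonZero; _≤_; _<_; z≤n; s≤s; +-0-rawMonoid)
open import Data.Nat.Divisibility
  using (_∣_; divides; _∣?_; _∣0; ∣-refl; ∣m∣n⇒∣m+n; ∣m+n∣m⇒∣n; m∣m*n; n∣m*n; ∣n⇒∣m*n;
         >⇒∤; %-presˡ-∣; ∣n∣m%n⇒∣m)
open import Data.Nat.DivMod using (_mod_; _/_; _%_; m%n<n; m<n⇒m%n≡m; %-distribˡ-+; m≡m%n+[m/n]*n)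
open import Data.Nat.Induction using (<-rec)
import Data.Nat.Properties as ℕ
open import Data.Nat.Tactic.RingSolver using (solve-∀)
open import Data.Product.Base using (∃-syntax; _×_; _,_; proj₁; proj₂)
import Data.Sum.Base as Sum
open import Data.Sum.Base using (_⊎_; inj₁; inj₂)
open import Data.Vec.Base as Vec using ([]; _∷_; here; there)
open import Data.Vec.Functional as Vector using (Vector)
open import Data.Vec.Properties using (lookup∘tabulate; lookup⇒[]=; []=⇒lookup)
open import Function.Base using (_∘_; it)
open import Function.Definitions using (Injective)
open import Relation.Binary.PropositionalEquality
open import Relation.Nullary using (¬_; yes; no; contradiction)
open import Relation.Nullary.Decidable
  using (does; dec-true; _×-dec_; _→-dec_; ¬?; decidable-stable)
open import Relation.Unary using (Decidable)

-- Counting in finite subsets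

module _ {n : ℕ} {P : Fin n → Set} (P? : Decidable P) where

  select : Subset n
  select = Vec.tabulate (does ∘ P?)

  ∈-select⁺ : ∀ {x} → P x → x ∈ select
  ∈-select⁺ {x} px = lookup⇒[]= x select (trans (lookup∘tabulate _ x) (dec-true (P? x) px))

  ∈-select⁻ : ∀ {x} → x ∈ select → P x
  ∈-select⁻ {x} x∈ with P? x | trans (sym (lookup∘tabulate (does ∘ P?) x)) ([]=⇒lookup x∈)
  ... | yes px | _ = px

-- Each point of `p` uses up its own image: once `zero` is matched with `f zero`, injectivity sends
-- the remaining points into `q - f zero`.
injection⇒∣p∣≤∣q∣ : ∀ {m n} {f : Fin m → Fin n} → Injective _≡_ _≡_ f →
                   ∀ p q → (∀ {x} → x ∈ p → f x ∈ q) → ∣ p ∣ ≤ ∣ q ∣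
injection⇒∣p∣≤∣q∣ inj []            q maps = z≤n
injection⇒∣p∣≤∣q∣ inj (outside ∷ p) q maps =
  injection⇒∣p∣≤∣q∣ (suc-injective ∘ inj) p q (maps ∘ there)
injection⇒∣p∣≤∣q∣ {f = f} inj (inside ∷ p) q maps = ℕ.≤-trans
  (s≤s (injection⇒∣p∣≤∣q∣ (suc-injective ∘ inj) p (q - f zero)
    (λ x∈p → x∈p∧x≢y⇒x∈p-y (maps (there x∈p)) (λ eq → 0≢1+n (sym (inj eq))))))
  (x∈p⇒∣p-x∣<∣p∣ (maps here))

∣p∪q∣+∣p∩q∣≡∣p∣+∣q∣ : ∀ {n} (p q : Subset n) → ∣ p ∪ q ∣ ℕ.+ ∣ p ∩ q ∣ ≡ ∣ p ∣ ℕ.+ ∣ q ∣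
∣p∪q∣+∣p∩q∣≡∣p∣+∣q∣ []            []            = refl
∣p∪q∣+∣p∩q∣≡∣p∣+∣q∣ (outside ∷ p) (outside ∷ q) = ∣p∪q∣+∣p∩q∣≡∣p∣+∣q∣ p q
∣p∪q∣+∣p∩q∣≡∣p∣+∣q∣ (outside ∷ p) (inside  ∷ q) =
  trans (cong suc (∣p∪q∣+∣p∩q∣≡∣p∣+∣q∣ p q)) (sym (ℕ.+-suc ∣ p ∣ ∣ q ∣))
∣p∪q∣+∣p∩q∣≡∣p∣+∣q∣ (inside  ∷ p) (outside ∷ q) = cong suc (∣p∪q∣+∣p∩q∣≡∣p∣+∣q∣ p q)
∣p∪q∣+∣p∩q∣≡∣p∣+∣q∣ (inside  ∷ p) (inside  ∷ q) = cong suc (trans (ℕ.+-suc _ _)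
  (trans (cong suc (∣p∪q∣+∣p∩q∣≡∣p∣+∣q∣ p q)) (sym (ℕ.+-suc ∣ p ∣ ∣ q ∣))))

-- Inclusion-exclusion: `p ∪ q` fits into `r` and `p ∩ q` into `s`.
∣p∣+∣q∣≤∣r∣+∣s∣ : ∀ {n} {p q r s : Subset n} → p ⊆ r → q ⊆ r →
                 (∀ {x} → x ∈ p → x ∈ q → x ∈ s) → ∣ p ∣ ℕ.+ ∣ q ∣ ≤ ∣ r ∣ ℕ.+ ∣ s ∣
∣p∣+∣q∣≤∣r∣+∣s∣ {p = p} {q} {r} {s} p⊆r q⊆r p∩q⊆s =
  subst (_≤ ∣ r ∣ ℕ.+ ∣ s ∣) (∣p∪q∣+∣p∩q∣≡∣p∣+∣q∣ p q) (ℕ.+-mono-≤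
    (p⊆q⇒∣p∣≤∣q∣ (λ x∈ → Sum.[ p⊆r , q⊆r ] (x∈p∪q⁻ p q x∈)))
    (p⊆q⇒∣p∣≤∣q∣ (λ x∈ → let x∈p , x∈q = x∈p∩q⁻ p q x∈ in p∩q⊆s x∈p x∈q)))

∣p∣+∣q∣≤∣r∣ : ∀ {n} {p q r : Subset n} → p ⊆ r → q ⊆ r → (∀ {x} → x ∈ p → x ∉ q) →
             ∣ p ∣ ℕ.+ ∣ q ∣ ≤ ∣ r ∣
∣p∣+∣q∣≤∣r∣ {n} {p} {q} {r} p⊆r q⊆r p∩q≡∅ = begin
  ∣ p ∣ ℕ.+ ∣ q ∣       ≤⟨ ∣p∣+∣q∣≤∣r∣+∣s∣ {s = ⊥} p⊆r q⊆r (λ x∈p x∈q → contradiction x∈q (p∩q≡∅ x∈p)) ⟩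
  ∣ r ∣ ℕ.+ ∣ ⊥ {n} ∣   ≡⟨ cong (∣ r ∣ ℕ.+_) (∣⊥∣≡0 n) ⟩
  ∣ r ∣ ℕ.+ 0           ≡⟨ ℕ.+-identityʳ _ ⟩
  ∣ r ∣                 ∎
  where open ℕ.≤-Reasoning

∣r∣≤∣p∣+∣q∣ : ∀ {n} {p q r : Subset n} → (∀ {x} → x ∈ r → x ∈ p ⊎ x ∈ q) →
             ∣ r ∣ ≤ ∣ p ∣ ℕ.+ ∣ q ∣
∣r∣≤∣p∣+∣q∣ {p = p} {q} {r} cover = begin
  ∣ r ∣                       ≤⟨ p⊆q⇒∣p∣≤∣q∣ (x∈p∪q⁺ ∘ cover) ⟩
  ∣ p ∪ q ∣                   ≤⟨ ℕ.m≤m+n _ _ ⟩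
  ∣ p ∪ q ∣ ℕ.+ ∣ p ∩ q ∣     ≡⟨ ∣p∪q∣+∣p∩q∣≡∣p∣+∣q∣ p q ⟩
  ∣ p ∣ ℕ.+ ∣ q ∣             ∎
  where open ℕ.≤-Reasoning

p⊆q∧∣q∣≤∣p∣⇒q⊆p : ∀ {n} {p q : Subset n} → p ⊆ q → ∣ q ∣ ≤ ∣ p ∣ → q ⊆ p
p⊆q∧∣q∣≤∣p∣⇒q⊆p {p = p} {q} p⊆q ∣q∣≤∣p∣ {x} x∈q = decidable-stable (x ∈? p) λ x∉p →
  ℕ.≤⇒≯ ∣q∣≤∣p∣ (p⊂q⇒∣p∣<∣q∣ (p⊆q , x , x∈q , x∉p))

subsetOf : ∀ {n m} (p : Subset n) → m ≤ ∣ p ∣ → ∃[ q ] q ⊆ p × ∣ q ∣ ≡ m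
subsetOf {n} {zero} p m≤ = ⊥ , (λ x∈ → contradiction x∈ ∉⊥) , ∣⊥∣≡0 n
subsetOf {m = suc m} (outside ∷ p) m≤ with q , q⊆p , ∣q∣≡ ← subsetOf p m≤ =
  outside ∷ q , s⊆s q⊆p , ∣q∣≡
subsetOf {m = suc m} (inside ∷ p) (s≤s m≤) with q , q⊆p , ∣q∣≡ ← subsetOf p m≤ =
  inside ∷ q , s⊆s q⊆p , cong suc ∣q∣≡

⊆⊎∃∉ : ∀ {n} (p q : Subset n) → p ⊆ q ⊎ ∃[ x ] x ∈ p × x ∉ q
⊆⊎∃∉ p q with any? (λ x → x ∈? p ×-dec ¬? (x ∈? q))
... | yes new = inj₂ new
... | no  ∄   = inj₁ (λ {x} x∈p → decidable-stable (x ∈? q) (λ x∉q → ∄ (x , x∈p , x∉q)))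

-- Sumsets and stabilizers in a finite abelian group

module _ {n : ℕ} (G : FiniteAbelianGroup n) where

  open FiniteAbelianGroup G
  open AbelianGroup abelianGroup using (monoid; assoc; comm; identityˡ; identityʳ; inverseʳ; inverseˡ)
    renaming (_-_ to _−_)
  open AbelianGroupProperties abelianGroup 
    using (∙-cancelˡ; ∙-cancelʳ; ε⁻¹≈ε; xyx⁻¹≈y; ⁻¹-∙-comm; ⁻¹-involutive; inverseˡ-unique)
    renaming (//-rightDividesˡ to x−y+y≡x; //-rightDividesʳ to x+y−y≡x)

  open MonoidMult monoid using (×-homo-+)

  swapʳ : ∀ x y z → (x + y) + z ≡ (x + z) + y
  swapʳ x y z = trans (assoc x y z) (trans (cong (x +_) (comm y z)) (sym (assoc x z y)))

  swapˡ : ∀ x y z → x + (y + z) ≡ y + (x + z)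
  swapˡ x y z = trans (sym (assoc x y z)) (trans (cong (_+ z) (comm x y)) (assoc y x z))

  medial : ∀ w x y z → (w + x) + (y + z) ≡ (w + y) + (x + z)
  medial w x y z = trans (sym (assoc (w + x) y z))
    (trans (cong (_+ z) (swapʳ w x y)) (assoc (w + y) x z))

  y+[x−y]≡x : ∀ x y → y + (x − y) ≡ x
  y+[x−y]≡x x y = trans (comm y _) (x−y+y≡x y x)

  [x+y]+[z−y]≡x+z : ∀ x y z → (x + y) + (z − y) ≡ x + z
  [x+y]+[z−y]≡x+z x y z = trans (assoc x y _) (cong (x +_) (y+[x−y]≡x z y))

  translate⇒∣p∣≤∣q∣ : ∀ g {p q : Subset n} → (∀ {x} → x ∈ p → g + x ∈ q) → ∣ p ∣ ≤ ∣ q ∣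
  translate⇒∣p∣≤∣q∣ g {p} {q} = injection⇒∣p∣≤∣q∣ (∙-cancelˡ g _ _) p q

  isPairSum? : ∀ A B → Decidable (λ x → ∃[ a ] a ∈ A × ∃[ b ] b ∈ B × a + b ≡ x)
  isPairSum? A B x = any? (λ a → a ∈? A ×-dec any? (λ b → b ∈? B ×-dec (a + b) ≟ x))

  infixl 6 _⊕_
  _⊕_ : Subset n → Subset n → Subset n
  A ⊕ B = select (isPairSum? A B)

  module _ {A B : Subset n} where

    ∈-⊕⁺ : ∀ {a b} → a ∈ A → b ∈ B → a + b ∈ A ⊕ B
    ∈-⊕⁺ a∈A b∈B = ∈-select⁺ (isPairSum? A B) (_ , a∈A , _ , b∈B , refl)

    ∈-⊕⁻ : ∀ {x} → x ∈ A ⊕ B → ∃[ a ] a ∈ A × ∃[ b ] b ∈ B × a + b ≡ x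
    ∈-⊕⁻ = ∈-select⁻ (isPairSum? A B)

  stabilizes? : ∀ X → Decidable (λ g → ∀ x → x ∈ X → x + g ∈ X)
  stabilizes? X g = all? (λ x → x ∈? X →-dec (x + g) ∈? X)

  stab : Subset n → Subset n
  stab X = select (stabilizes? X)

  module _ {X : Subset n} where

    ∈-stab⁺ : ∀ {g} → (∀ {x} → x ∈ X → x + g ∈ X) → g ∈ stab X
    ∈-stab⁺ g-stab = ∈-select⁺ (stabilizes? X) (λ _ → g-stab)

    ∈-stab⁻ : ∀ {g} → g ∈ stab X → ∀ {x} → x ∈ X → x + g ∈ X
    ∈-stab⁻ g∈ = ∈-select⁻ (stabilizes? X) g∈ _

    -- The points that `g` moves into `X` include `X` itself and inject into `X` by translation, so
    -- by finiteness there are no others. This serves in place of translating back by `- g`.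
    stab-reflects : ∀ {g} → g ∈ stab X → ∀ {x} → x + g ∈ X → x ∈ X
    stab-reflects {g} g∈ x+g∈X = p⊆q∧∣q∣≤∣p∣⇒q⊆p
      (λ x∈X → ∈-select⁺ X−g? (∈-stab⁻ g∈ x∈X))
      (translate⇒∣p∣≤∣q∣ g (λ x∈ → subst (_∈ X) (comm _ g) (∈-select⁻ X−g? x∈)))
      (∈-select⁺ X−g? x+g∈X)
      where
      X−g? : Decidable (λ x → x + g ∈ X)
      X−g? x = (x + g) ∈? X

  -- `H ⊆ stab H` is closure under addition; closure under negation then follows from finiteness,
  -- through `stab-reflects`.
  IsSubgroup : Subset n → Set
  IsSubgroup H = 0# ∈ H × H ⊆ stab H

  stab-isSubgroup : ∀ X → IsSubgroup (stab X)
  stab-isSubgroup X =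
    ∈-stab⁺ (λ {x} → subst (_∈ X) (sym (identityʳ x))) ,
    λ h∈ → ∈-stab⁺ λ g∈ → ∈-stab⁺ λ {x} x∈X →
      subst (_∈ X) (assoc x _ _) (∈-stab⁻ h∈ (∈-stab⁻ g∈ x∈X))

  stab-⊕ : ∀ A B → stab B ⊆ stab (A ⊕ B)
  stab-⊕ A B g∈ = ∈-stab⁺ λ x∈ → let a , a∈A , b , b∈B , a+b≡x = ∈-⊕⁻ x∈ in
    subst (_∈ A ⊕ B) (trans (sym (assoc a b _)) (cong (_+ _) a+b≡x)) (∈-⊕⁺ a∈A (∈-stab⁻ g∈ b∈B))

  stab-∪ : ∀ X Y {g} → g ∈ stab X → g ∈ stab Y → g ∈ stab (X ∪ Y)
  stab-∪ X Y g∈X g∈Y = ∈-stab⁺ λ x∈ →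
    x∈p∪q⁺ (Sum.map (∈-stab⁻ g∈X) (∈-stab⁻ g∈Y) (x∈p∪q⁻ X Y x∈))

  -- Kneser's theorem

  module _ (X Y : Subset n) (x : Fin n) where

    -- For x ∈ Y ∖ X, both x + keeping and x + avoiding lie in Y ∖ X.
    keeping? : Decidable (λ h → h ∈ stab X × x + h ∈ Y)
    keeping? h = h ∈? stab X ×-dec (x + h) ∈? Y

    avoiding? : Decidable (λ h → h ∈ stab Y × x + h ∉ X)
    avoiding? h = h ∈? stab Y ×-dec ¬? ((x + h) ∈? X)

    keeping avoiding : Subset n
    keeping = select keeping?
    avoiding = select avoiding?

    -- `keeping` lies in `stab X` and `avoiding` in `stab Y`, so whatever they share is counted by
    -- `S`.
    ∣keeping∣+∣avoiding∣≤ : ∀ {S} → (∀ {g} → g ∈ stab X → g ∈ stab Y → g ∈ S) → x ∈ Y → x ∉ X →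
              ∣ keeping ∣ ℕ.+ ∣ avoiding ∣ ≤ ∣ Y ∩ ∁ X ∣ ℕ.+ ∣ S ∣
    ∣keeping∣+∣avoiding∣≤ {S} ⊆S x∈Y x∉X = ℕ.≤-trans
      (∣p∣+∣q∣≤∣r∣+∣s∣ {r = select R?} keeping⊆R avoiding⊆R
        (λ h∈k h∈a → ⊆S (proj₁ (∈-select⁻ keeping? h∈k)) (proj₁ (∈-select⁻ avoiding? h∈a))))
      (ℕ.+-monoˡ-≤ ∣ S ∣ (translate⇒∣p∣≤∣q∣ x (∈-select⁻ R?)))
      where
      R? : Decidable (λ h → x + h ∈ Y ∩ ∁ X)
      R? h = (x + h) ∈? (Y ∩ ∁ X)

      keeping⊆R : keeping ⊆ select R?
      keeping⊆R h∈k with h∈ , x+h∈Y ← ∈-select⁻ keeping? h∈k =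
        ∈-select⁺ R? (x∈p∩q⁺ (x+h∈Y , x∉p⇒x∈∁p (x∉X ∘ stab-reflects h∈)))

      avoiding⊆R : avoiding ⊆ select R?
      avoiding⊆R h∈a with h∈ , x+h∉X ← ∈-select⁻ avoiding? h∈a =
        ∈-select⁺ R? (x∈p∩q⁺ (∈-stab⁻ h∈ x∈Y , x∉p⇒x∈∁p x+h∉X))

  module _ (X Y : Subset n) {x h₁ h₂ : Fin n} (h₁∈ : h₁ ∈ stab X) (h₂∈ : h₂ ∈ stab Y) where

    private
      y : Fin n
      y = (x + h₁) + h₂

    -- The elements `h` of `stab X` outside `keeping X Y x` have `x + h ∉ Y`. Since
    -- `y + (h − h₁) = (x + h) + h₂` and `h₂` stabilizes `Y`, translation by `- h₁` carries them
    -- into `avoiding Y X y`.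
    ∣stabX∣≤ : ∣ stab X ∣ ≤ ∣ keeping X Y x ∣ ℕ.+ ∣ avoiding Y X y ∣
    ∣stabX∣≤ = ℕ.≤-trans (∣r∣≤∣p∣+∣q∣ {q = select R?} cover)
      (ℕ.+-monoʳ-≤ ∣ keeping X Y x ∣ (translate⇒∣p∣≤∣q∣ (- h₁) R→avoiding))
      where
      R? : Decidable (λ h → h ∈ stab X × x + h ∉ Y)
      R? h = h ∈? stab X ×-dec ¬? ((x + h) ∈? Y)

      cover : ∀ {h} → h ∈ stab X → h ∈ keeping X Y x ⊎ h ∈ select R?
      cover {h} h∈ with (x + h) ∈? Y
      ... | yes x+h∈Y = inj₁ (∈-select⁺ (keeping? X Y x) (h∈ , x+h∈Y))
      ... | no  x+h∉Y = inj₂ (∈-select⁺ R? (h∈ , x+h∉Y))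

      R→avoiding : ∀ {h} → h ∈ select R? → - h₁ + h ∈ avoiding Y X y
      R→avoiding {h} h∈R with h∈ , x+h∉Y ← ∈-select⁻ R? h∈R = ∈-select⁺ (avoiding? Y X y)
        ( stab-reflects (proj₂ (stab-isSubgroup X) h₁∈)
            (subst (_∈ stab X) (sym (trans (cong (_+ h₁) (comm (- h₁) h)) (x−y+y≡x h₁ h))) h∈)
        , λ y+h∈Y → x+h∉Y (stab-reflects h₂∈ (subst (_∈ Y) eq y+h∈Y)) )
        where
        eq : y + (- h₁ + h) ≡ (x + h) + h₂
        eq = begin
          ((x + h₁) + h₂) + (- h₁ + h)   ≡⟨ cong (y +_) (comm (- h₁) h) ⟩
          ((x + h₁) + h₂) + (h − h₁)     ≡⟨ swapʳ (x + h₁) h₂ (h − h₁) ⟩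
          ((x + h₁) + (h − h₁)) + h₂     ≡⟨ cong (_+ h₂) ([x+y]+[z−y]≡x+z x h₁ h) ⟩
          (x + h) + h₂                   ∎
          where open ≡-Reasoning

    -- The mirror image: now `y + (h − h₂) = (x + h) + h₁`, which stays in `X` because `h₁`
    -- stabilizes `X`.
    ∣stabY∣≤ : ∣ stab Y ∣ ≤ ∣ avoiding X Y x ∣ ℕ.+ ∣ keeping Y X y ∣
    ∣stabY∣≤ = ℕ.≤-trans (∣r∣≤∣p∣+∣q∣ {q = select R?} cover)
      (ℕ.+-monoʳ-≤ ∣ avoiding X Y x ∣ (translate⇒∣p∣≤∣q∣ (- h₂) R→keeping))
      where
      R? : Decidable (λ h → h ∈ stab Y × x + h ∈ X)
      R? h = h ∈? stab Y ×-dec (x + h) ∈? X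

      cover : ∀ {h} → h ∈ stab Y → h ∈ avoiding X Y x ⊎ h ∈ select R?
      cover {h} h∈ with (x + h) ∈? X
      ... | yes x+h∈X = inj₂ (∈-select⁺ R? (h∈ , x+h∈X))
      ... | no  x+h∉X = inj₁ (∈-select⁺ (avoiding? X Y x) (h∈ , x+h∉X))

      R→keeping : ∀ {h} → h ∈ select R? → - h₂ + h ∈ keeping Y X y
      R→keeping {h} h∈R with h∈ , x+h∈X ← ∈-select⁻ R? h∈R = ∈-select⁺ (keeping? Y X y)
        ( stab-reflects (proj₂ (stab-isSubgroup Y) h₂∈)
            (subst (_∈ stab Y) (sym (trans (cong (_+ h₂) (comm (- h₂) h)) (x−y+y≡x h₂ h))) h∈)
        , subst (_∈ X) (sym eq) (∈-stab⁻ h₁∈ x+h∈X) )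
        where
        eq : y + (- h₂ + h) ≡ (x + h) + h₁
        eq = begin
          ((x + h₁) + h₂) + (- h₂ + h)   ≡⟨ cong (y +_) (comm (- h₂) h) ⟩
          ((x + h₁) + h₂) + (h − h₂)     ≡⟨ [x+y]+[z−y]≡x+z (x + h₁) h₂ h ⟩
          (x + h₁) + h                   ≡⟨ swapʳ x h₁ h ⟩
          (x + h) + h₁                   ∎
          where open ≡-Reasoning

  -- If x + h₁ ∉ Y and x + h₂ ∈ X, then y = x + h₁ + h₂ lies in X ∖ Y in the same coset of
  -- stab X + stab Y as x, so keeping and avoiding at x and at y complement each other.
  difference-bound : ∀ X Y S → (∀ {g} → g ∈ stab X → g ∈ stab Y → g ∈ S) →
    ∀ {x} → x ∈ Y → x ∉ X →
    ∣ stab X ∣ ≤ ∣ Y ∩ ∁ X ∣ ⊎ ∣ stab Y ∣ ≤ ∣ Y ∩ ∁ X ∣ ⊎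
    ∣ stab X ∣ ℕ.+ ∣ stab Y ∣ ≤ (∣ Y ∩ ∁ X ∣ ℕ.+ ∣ S ∣) ℕ.+ (∣ X ∩ ∁ Y ∣ ℕ.+ ∣ S ∣)
  difference-bound X Y S ⊆S {x} x∈Y x∉X
    with any? (λ h → h ∈? stab X ×-dec ¬? ((x + h) ∈? Y))
       | any? (λ h → h ∈? stab Y ×-dec (x + h) ∈? X)
  -- Without `h₁` the whole coset `x + stab X` lies in `Y ∩ ∁ X`; without `h₂` the coset
  -- `x + stab Y` does.
  ... | no ∄h₁ | _ = inj₁ (translate⇒∣p∣≤∣q∣ x λ {h} h∈ → x∈p∩q⁺
    ( decidable-stable ((x + h) ∈? Y) (λ x+h∉Y → ∄h₁ (h , h∈ , x+h∉Y))
    , x∉p⇒x∈∁p (x∉X ∘ stab-reflects h∈) ))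
  ... | yes _ | no ∄h₂ = inj₂ (inj₁ (translate⇒∣p∣≤∣q∣ x λ {h} h∈ → x∈p∩q⁺
    ( ∈-stab⁻ h∈ x∈Y
    , x∉p⇒x∈∁p (λ x+h∈X → ∄h₂ (h , h∈ , x+h∈X)) )))
  ... | yes (h₁ , h₁∈ , x+h₁∉Y) | yes (h₂ , h₂∈ , x+h₂∈X) = inj₂ (inj₂ (begin
    ∣ stab X ∣ ℕ.+ ∣ stab Y ∣
      ≤⟨ ℕ.+-mono-≤ (∣stabX∣≤ X Y h₁∈ h₂∈) (∣stabY∣≤ X Y h₁∈ h₂∈) ⟩
    (∣ keeping X Y x ∣ ℕ.+ ∣ avoiding Y X y ∣) ℕ.+ (∣ avoiding X Y x ∣ ℕ.+ ∣ keeping Y X y ∣)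
      ≡⟨ shuffle (∣ keeping X Y x ∣) (∣ avoiding Y X y ∣) _ _ ⟩
    (∣ keeping X Y x ∣ ℕ.+ ∣ avoiding X Y x ∣) ℕ.+ (∣ keeping Y X y ∣ ℕ.+ ∣ avoiding Y X y ∣)
      ≤⟨ ℕ.+-mono-≤ (∣keeping∣+∣avoiding∣≤ X Y x ⊆S x∈Y x∉X)
                    (∣keeping∣+∣avoiding∣≤ Y X y (λ g∈Y g∈X → ⊆S g∈X g∈Y) y∈X (x+h₁∉Y ∘ stab-reflects h₂∈)) ⟩
    (∣ Y ∩ ∁ X ∣ ℕ.+ ∣ S ∣) ℕ.+ (∣ X ∩ ∁ Y ∣ ℕ.+ ∣ S ∣) ∎))
    where
    open ℕ.≤-Reasoning

    y : Fin n
    y = (x + h₁) + h₂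

    y∈X : y ∈ X
    y∈X = subst (_∈ X) (swapʳ x h₂ h₁) (∈-stab⁻ h₁∈ x+h₂∈X)

    shuffle : ∀ a b c d → (a ℕ.+ b) ℕ.+ (c ℕ.+ d) ≡ (a ℕ.+ c) ℕ.+ (d ℕ.+ b)
    shuffle = solve-∀

  -- Every point of A ⊕ B lies in a large part of A ⊕ B (large-part below), and unions of
  -- large sets are large, so A ⊕ B is large.
  IsLarge : ℕ → Subset n → Set
  IsLarge s X = s ≤ ∣ X ∣ ℕ.+ ∣ stab X ∣

  -- Nested sets are trivial. Otherwise `X ∪ Y` exceeds `X` by `α` points and `Y` by `β`, so either
  -- `m₁ ≤ α + m` or `m₂ ≤ β + m` suffices. Applying `difference-bound` in both directions always
  -- yields one of the two.
  ∪-isLarge : ∀ {s X Y} → IsLarge s X → IsLarge s Y → IsLarge s (X ∪ Y)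
  ∪-isLarge {s} {X} {Y} large-X large-Y with ⊆⊎∃∉ Y X | ⊆⊎∃∉ X Y
  ... | inj₁ Y⊆X | _ = subst (IsLarge s) (⊆-antisym (p⊆p∪q Y)
    (λ x∈ → Sum.[ (λ x∈X → x∈X) , Y⊆X ] (x∈p∪q⁻ X Y x∈))) large-X
  ... | inj₂ _ | inj₁ X⊆Y = subst (IsLarge s) (⊆-antisym (q⊆p∪q X Y)
    (λ x∈ → Sum.[ X⊆Y , (λ x∈Y → x∈Y) ] (x∈p∪q⁻ X Y x∈))) large-Y
  ... | inj₂ (x , x∈Y , x∉X) | inj₂ (y , y∈X , y∉Y) = combine
    (difference-bound X Y _ (stab-∪ X Y) x∈Y x∉X)
    (difference-bound Y X _ (λ g∈Y g∈X → stab-∪ X Y g∈X g∈Y) y∈X y∉Y)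
    where
    α β m₁ m₂ m : ℕ
    α  = ∣ Y ∩ ∁ X ∣
    β  = ∣ X ∩ ∁ Y ∣
    m₁ = ∣ stab X ∣
    m₂ = ∣ stab Y ∣
    m  = ∣ stab (X ∪ Y) ∣

    open ℕ.≤-Reasoning

    via-X : m₁ ≤ α ℕ.+ m → IsLarge s (X ∪ Y)
    via-X m₁≤ = begin
      s                      ≤⟨ large-X ⟩
      ∣ X ∣ ℕ.+ m₁           ≤⟨ ℕ.+-monoʳ-≤ ∣ X ∣ m₁≤ ⟩
      ∣ X ∣ ℕ.+ (α ℕ.+ m)    ≡⟨ ℕ.+-assoc ∣ X ∣ α m ⟨
      ∣ X ∣ ℕ.+ α ℕ.+ m      ≤⟨ ℕ.+-monoˡ-≤ m (∣p∣+∣q∣≤∣r∣ (p⊆p∪q Y)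
                                 (q⊆p∪q X Y ∘ p∩q⊆p Y (∁ X))
                                 (λ x∈X → x∈p⇒x∉∁p x∈X ∘ p∩q⊆q Y (∁ X))) ⟩
      ∣ X ∪ Y ∣ ℕ.+ m        ∎

    via-Y : m₂ ≤ β ℕ.+ m → IsLarge s (X ∪ Y)
    via-Y m₂≤ = begin
      s                      ≤⟨ large-Y ⟩
      ∣ Y ∣ ℕ.+ m₂           ≤⟨ ℕ.+-monoʳ-≤ ∣ Y ∣ m₂≤ ⟩
      ∣ Y ∣ ℕ.+ (β ℕ.+ m)    ≡⟨ ℕ.+-assoc ∣ Y ∣ β m ⟨
      ∣ Y ∣ ℕ.+ β ℕ.+ m      ≤⟨ ℕ.+-monoˡ-≤ m (∣p∣+∣q∣≤∣r∣ (q⊆p∪q X Y)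
                                 (p⊆p∪q Y ∘ p∩q⊆p X (∁ Y))
                                 (λ x∈Y → x∈p⇒x∉∁p x∈Y ∘ p∩q⊆q X (∁ Y))) ⟩
      ∣ X ∪ Y ∣ ℕ.+ m        ∎

    combine : m₁ ≤ α ⊎ m₂ ≤ α ⊎ m₁ ℕ.+ m₂ ≤ (α ℕ.+ m) ℕ.+ (β ℕ.+ m) →
              m₂ ≤ β ⊎ m₁ ≤ β ⊎ m₂ ℕ.+ m₁ ≤ (β ℕ.+ m) ℕ.+ (α ℕ.+ m) →
              IsLarge s (X ∪ Y)
    combine (inj₁ m₁≤α) _ = via-X (ℕ.m≤n⇒m≤n+o m m₁≤α)
    combine _ (inj₁ m₂≤β) = via-Y (ℕ.m≤n⇒m≤n+o m m₂≤β)
    -- The two bounds are crossed; comparing `m₁` with `m₂` uncrosses one of them.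
    combine (inj₂ (inj₁ m₂≤α)) (inj₂ (inj₁ m₁≤β)) with ℕ.≤-total m₁ m₂
    ... | inj₁ m₁≤m₂ = via-X (ℕ.m≤n⇒m≤n+o m (ℕ.≤-trans m₁≤m₂ m₂≤α))
    ... | inj₂ m₂≤m₁ = via-Y (ℕ.m≤n⇒m≤n+o m (ℕ.≤-trans m₂≤m₁ m₁≤β))
    combine (inj₂ (inj₂ sum≤)) _ with ℕ.≤-total m₁ (α ℕ.+ m)
    -- If `m₁` is at least `α + m`, cancelling `α + m` from the bound on the sum leaves
    -- `m₂ ≤ β + m`.
    ... | inj₁ m₁≤ = via-X m₁≤
    ... | inj₂ ≤m₁ = via-Y (ℕ.+-cancelˡ-≤ (α ℕ.+ m) _ _ (ℕ.≤-trans (ℕ.+-monoˡ-≤ m₂ ≤m₁) sum≤))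
    combine _ (inj₂ (inj₂ sum≤)) with ℕ.≤-total m₂ (β ℕ.+ m)
    ... | inj₁ m₂≤ = via-Y m₂≤
    ... | inj₂ ≤m₂ = via-X (ℕ.+-cancelˡ-≤ (β ℕ.+ m) _ _ (ℕ.≤-trans (ℕ.+-monoˡ-≤ m₁ ≤m₂) sum≤))

  -- Dyson's transform: replacing A, B by A ∪ (B + e), B ∩ (A − e) with e = a − b₀ shrinks B
  -- unless A + (B − b₀) ⊆ A for all choices of a, that is, B − b₀ ⊆ stab A.
  large-part : ∀ k A B → ∣ B ∣ < k → ∀ {a₀ b₀} → a₀ ∈ A → b₀ ∈ B →
               ∃[ C ] a₀ + b₀ ∈ C × C ⊆ A ⊕ B × IsLarge (∣ A ∣ ℕ.+ ∣ B ∣) C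
  large-part (suc k) A B (s≤s ∣B∣≤k) {a₀} {b₀} a₀∈A b₀∈B
    with any? (λ a → a ∈? A ×-dec any? (λ b → b ∈? B ×-dec ¬? ((b + (a − b₀)) ∈? A)))
  ... | yes (a , a∈A , b , b∈B , b+e∉A) =
    -- `b₀` survives in `B′` because `b₀ + e = a`, so the recursion keeps following the same point
    -- `a₀ + b₀`.
    let C , ∈C , C⊆ , large = large-part k A′ B′ ∣B′∣<k (x∈p∪q⁺ (inj₁ a₀∈A)) b₀∈B′
    in C , ∈C , A′⊕B′⊆A⊕B ∘ C⊆ , ℕ.≤-trans ∣A∣+∣B∣≤ large
    where
    e : Fin n
    e = a − b₀

    B+e? : Decidable (λ x → x − e ∈ B)
    B+e? x = (x − e) ∈? B

    A′ : Subset n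
    A′ = A ∪ select B+e?

    B′? : Decidable (λ y → y ∈ B × y + e ∈ A)
    B′? y = y ∈? B ×-dec (y + e) ∈? A

    B′ : Subset n
    B′ = select B′?

    b₀∈B′ : b₀ ∈ B′
    b₀∈B′ = ∈-select⁺ B′? (b₀∈B , subst (_∈ A) (sym (y+[x−y]≡x a b₀)) a∈A)

    ∣B′∣<k : ∣ B′ ∣ < k
    ∣B′∣<k = ℕ.<-≤-trans (p⊂q⇒∣p∣<∣q∣
      (proj₁ ∘ ∈-select⁻ B′? , b , b∈B , b+e∉A ∘ proj₂ ∘ ∈-select⁻ B′?)) ∣B∣≤k

    A′⊕B′⊆A⊕B : A′ ⊕ B′ ⊆ A ⊕ B
    A′⊕B′⊆A⊕B z∈ with ∈-⊕⁻ {A′} {B′} z∈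
    ... | x , x∈A′ , y , y∈B′ , refl with ∈-select⁻ B′? y∈B′ | x∈p∪q⁻ A _ x∈A′
    ... | y∈B , _     | inj₁ x∈A   = ∈-⊕⁺ x∈A y∈B
    -- Here `x + y` is rewritten as `(y + e) + (x − e)`, with the first summand in `A` and the
    -- second in `B`.
    ... | _   , y+e∈A | inj₂ x∈B+e = subst (_∈ A ⊕ B)
      (trans ([x+y]+[z−y]≡x+z y e x) (comm y x))
      (∈-⊕⁺ y+e∈A (∈-select⁻ B+e? x∈B+e))

    A∩[B+e]? : Decidable (λ x → x ∈ A × x − e ∈ B)
    A∩[B+e]? x = x ∈? A ×-dec B+e? x

    open ℕ.≤-Reasoning

    ∣A∣+∣B∣≤ : ∣ A ∣ ℕ.+ ∣ B ∣ ≤ ∣ A′ ∣ ℕ.+ ∣ B′ ∣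
    ∣A∣+∣B∣≤ = begin
      ∣ A ∣ ℕ.+ ∣ B ∣
        ≤⟨ ℕ.+-monoʳ-≤ ∣ A ∣ (translate⇒∣p∣≤∣q∣ e λ {b} b∈B →
             ∈-select⁺ B+e? (subst (_∈ B) (sym (xyx⁻¹≈y e b)) b∈B)) ⟩
      ∣ A ∣ ℕ.+ ∣ select B+e? ∣
        ≤⟨ ∣p∣+∣q∣≤∣r∣+∣s∣ (p⊆p∪q _) (q⊆p∪q A _)
             (λ x∈A x∈B+e → ∈-select⁺ A∩[B+e]? (x∈A , ∈-select⁻ B+e? x∈B+e)) ⟩
      ∣ A′ ∣ ℕ.+ ∣ select A∩[B+e]? ∣
        ≤⟨ ℕ.+-monoʳ-≤ ∣ A′ ∣ (translate⇒∣p∣≤∣q∣ (- e) λ {x} x∈ →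
             let x∈A , x−e∈B = ∈-select⁻ A∩[B+e]? x∈ in ∈-select⁺ B′?
             ( subst (_∈ B) (comm x (- e)) x−e∈B
             , subst (_∈ A) (sym (trans (cong (_+ e) (comm (- e) x)) (x−y+y≡x e x))) x∈A )) ⟩
      ∣ A′ ∣ ℕ.+ ∣ B′ ∣ ∎
  -- `C` is the translate `A + b₀`: it has at least the size of `A`, and by the failed search its
  -- stabilizer contains `B` translated by `- b₀`.
  ... | no ∄ = select A+b₀? , ∈-select⁺ A+b₀? (subst (_∈ A) (sym (x+y−y≡x b₀ a₀)) a₀∈A)
    , (λ {x} x∈ → subst (_∈ A ⊕ B) (x−y+y≡x b₀ x) (∈-⊕⁺ (∈-select⁻ A+b₀? x∈) b₀∈B))
    , ℕ.+-mono-≤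
        (translate⇒∣p∣≤∣q∣ b₀ λ {a} a∈A → ∈-select⁺ A+b₀? (subst (_∈ A) (sym (xyx⁻¹≈y b₀ a)) a∈A))
        (translate⇒∣p∣≤∣q∣ (- b₀) λ {b} b∈B → ∈-stab⁺ λ {x} x∈ →
          ∈-select⁺ A+b₀? (subst (_∈ A) (eq x b) (closed (∈-select⁻ A+b₀? x∈) b∈B)))
    where
    A+b₀? : Decidable (λ x → x − b₀ ∈ A)
    A+b₀? x = (x − b₀) ∈? A

    closed : ∀ {a b} → a ∈ A → b ∈ B → b + (a − b₀) ∈ A
    closed a∈A b∈B = decidable-stable (_ ∈? A) (λ ∉A → ∄ (_ , a∈A , _ , b∈B , ∉A))

    eq : ∀ x b → b + ((x − b₀) − b₀) ≡ (x + (- b₀ + b)) − b₀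
    eq x b = begin
      b + ((x − b₀) − b₀)       ≡⟨ comm b _ ⟩
      (x − b₀) + - b₀ + b       ≡⟨ assoc (x − b₀) (- b₀) b ⟩
      (x + - b₀) + (- b₀ + b)   ≡⟨ swapʳ x (- b₀) (- b₀ + b) ⟩
      (x + (- b₀ + b)) − b₀     ∎
      where open ≡-Reasoning

  -- `grow` adjoins a large part through a missing point until no point of `A ⊕ B` is missing; `k`
  -- bounds the number of points still missing.
  kneser : ∀ A B → Nonempty A → Nonempty B → IsLarge (∣ A ∣ ℕ.+ ∣ B ∣) (A ⊕ B)
  kneser A B (a₀ , a₀∈A) (b₀ , b₀∈B) =
    let C , _ , C⊆ , large = part a₀∈A b₀∈B in grow n C C⊆ large
      (ℕ.≤-trans (∣p∣≤n (A ⊕ B)) (ℕ.m≤n+m n ∣ C ∣))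
    where
    s : ℕ
    s = ∣ A ∣ ℕ.+ ∣ B ∣

    part : ∀ {a b} → a ∈ A → b ∈ B → ∃[ C ] a + b ∈ C × C ⊆ A ⊕ B × IsLarge s C
    part = large-part (suc ∣ B ∣) A B ℕ.≤-refl

    grow : ∀ k C → C ⊆ A ⊕ B → IsLarge s C → ∣ A ⊕ B ∣ ≤ ∣ C ∣ ℕ.+ k → IsLarge s (A ⊕ B)
    grow k C C⊆ large ≤C+k with ⊆⊎∃∉ (A ⊕ B) C
    ... | inj₁ ⊆C = subst (IsLarge s) (⊆-antisym C⊆ ⊆C) large
    grow zero C C⊆ large ≤C+0 | inj₂ new =
      contradiction (p⊂q⇒∣p∣<∣q∣ (C⊆ , new)) (ℕ.≤⇒≯ (subst (_ ≤_) (ℕ.+-identityʳ _) ≤C+0))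
    grow (suc k) C C⊆ large ≤C+k | inj₂ (x , x∈ , x∉C) with ∈-⊕⁻ {A} {B} x∈
    ... | a , a∈A , b , b∈B , refl with D , a+b∈D , D⊆ , large-D ← part a∈A b∈B =
      grow k (C ∪ D) (λ x∈ → Sum.[ C⊆ , D⊆ ] (x∈p∪q⁻ C D x∈)) (∪-isLarge large large-D) (begin
        ∣ A ⊕ B ∣              ≤⟨ ≤C+k ⟩
        ∣ C ∣ ℕ.+ suc k        ≡⟨ ℕ.+-suc ∣ C ∣ k ⟩
        suc ∣ C ∣ ℕ.+ k        ≤⟨ ℕ.+-monoˡ-≤ k (p⊂q⇒∣p∣<∣q∣
                                   (p⊆p∪q D , a + b , x∈p∪q⁺ (inj₂ a+b∈D) , x∉C)) ⟩
        ∣ C ∪ D ∣ ℕ.+ k        ∎)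
      where open ℕ.≤-Reasoning

  -- Subgroups, cosets and Lagrange's theorem

  module _ {H : Subset n} (H-sub : IsSubgroup H) where

    private
      0∈H : 0# ∈ H
      0∈H = proj₁ H-sub

      H⊆stabH : H ⊆ stab H
      H⊆stabH = proj₂ H-sub

    +-closed : ∀ {x y} → x ∈ H → y ∈ H → x + y ∈ H
    +-closed x∈H y∈H = ∈-stab⁻ (H⊆stabH y∈H) x∈H

    -‿closed : ∀ {x} → x ∈ H → - x ∈ H
    -‿closed {x} x∈H = stab-reflects (H⊆stabH x∈H) (subst (_∈ H) (sym (inverseˡ x)) 0∈H)

    coset? : ∀ y → Decidable (λ x → x − y ∈ H)
    coset? y x = (x − y) ∈? H

    coset : Fin n → Subset n
    coset y = select (coset? y)

    ∣coset∣≡∣H∣ : ∀ y → ∣ coset y ∣ ≡ ∣ H ∣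
    ∣coset∣≡∣H∣ y = ℕ.≤-antisym
      (translate⇒∣p∣≤∣q∣ (- y) λ {x} x∈ → subst (_∈ H) (comm x (- y)) (∈-select⁻ (coset? y) x∈))
      (translate⇒∣p∣≤∣q∣ y λ {x} x∈H → ∈-select⁺ (coset? y) (subst (_∈ H) (sym (xyx⁻¹≈y y x)) x∈H))

    -- A set stabilized by `H` is a union of cosets of `H`; they are split off one at a time, and
    -- the remainder `Y` is again stabilized by `H`. Besides the whole group, this applies to the
    -- set `A′` of `kneser-⊛`.
    lagrange : ∀ {X} → H ⊆ stab X → ∣ H ∣ ∣ ∣ X ∣
    lagrange = go _ _ ℕ.≤-refl
      where
      go : ∀ k X → ∣ X ∣ ≤ k → H ⊆ stab X → ∣ H ∣ ∣ ∣ X ∣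
      go k X ∣X∣≤k H⊆ with nonempty? X
      ... | no empty = subst (∣ H ∣ ∣_) (sym (trans (cong ∣_∣ (Empty-unique empty)) (∣⊥∣≡0 n))) (∣ H ∣ ∣0)
      ... | yes (y , y∈X) = remove k ∣X∣≤k
        where
        Y? : Decidable (λ x → x ∈ X × x ∉ coset y)
        Y? x = x ∈? X ×-dec ¬? (x ∈? coset y)

        Y : Subset n
        Y = select Y?

        coset⊆X : coset y ⊆ X
        coset⊆X {x} x∈ =
          subst (_∈ X) (y+[x−y]≡x x y) (∈-stab⁻ (H⊆ (∈-select⁻ (coset? y) x∈)) y∈X)

        y∈coset : y ∈ coset y
        y∈coset = ∈-select⁺ (coset? y) (subst (_∈ H) (sym (inverseʳ y)) 0∈H)

        H⊆stabY : H ⊆ stab Y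
        H⊆stabY {g} g∈H = ∈-stab⁺ λ {x} x∈Y → let x∈X , x∉ = ∈-select⁻ Y? x∈Y in ∈-select⁺ Y?
          ( ∈-stab⁻ (H⊆ g∈H) x∈X
          , λ x+g∈ → x∉ (∈-select⁺ (coset? y) (stab-reflects (H⊆stabH g∈H)
              (subst (_∈ H) (swapʳ x g (- y)) (∈-select⁻ (coset? y) x+g∈)))) )

        ∣H∣+∣Y∣≡∣X∣ : ∣ H ∣ ℕ.+ ∣ Y ∣ ≡ ∣ X ∣
        ∣H∣+∣Y∣≡∣X∣ = trans (cong (ℕ._+ ∣ Y ∣) (sym (∣coset∣≡∣H∣ y))) (ℕ.≤-antisym
          (∣p∣+∣q∣≤∣r∣ coset⊆X (proj₁ ∘ ∈-select⁻ Y?) (λ x∈ x∈Y → proj₂ (∈-select⁻ Y? x∈Y) x∈))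
          (∣r∣≤∣p∣+∣q∣ cover))
          where
          cover : ∀ {x} → x ∈ X → x ∈ coset y ⊎ x ∈ Y
          cover {x} x∈X with x ∈? coset y
          ... | yes x∈ = inj₁ x∈
          ... | no  x∉ = inj₂ (∈-select⁺ Y? (x∈X , x∉))

        remove : ∀ k → ∣ X ∣ ≤ k → ∣ H ∣ ∣ ∣ X ∣
        remove zero    ∣X∣≤0 = contradiction (x∈p⇒∣p-x∣<∣p∣ y∈X) (ℕ.≤⇒≯ (ℕ.≤-trans ∣X∣≤0 z≤n))
        remove (suc k) ∣X∣≤k = subst (∣ H ∣ ∣_) ∣H∣+∣Y∣≡∣X∣ (∣m∣n⇒∣m+n ∣-refl (go k Y
          (ℕ.≤-pred (ℕ.≤-trans (p⊂q⇒∣p∣<∣q∣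
            (proj₁ ∘ ∈-select⁻ Y? , y , y∈X , λ y∈Y → proj₂ (∈-select⁻ Y? y∈Y) y∈coset)) ∣X∣≤k))
          H⊆stabY))

  -- Iterated sumsets

  -- The sumset `hA + B`. The free starting set `B` allows the iteration to begin at a subgroup.
  foldSum : ℕ → Subset n → Subset n → Subset n
  foldSum zero    A B = B
  foldSum (suc h) A B = A ⊕ foldSum h A B

  infixr 7 _⊛_
  _⊛_ : ℕ → Subset n → Subset n
  h ⊛ A = foldSum h A ⁅ 0# ⁆

  foldSum-mono : ∀ h {A A′ B B′} → A ⊆ A′ → B ⊆ B′ → foldSum h A B ⊆ foldSum h A′ B′
  foldSum-mono zero    A⊆ B⊆ x∈ = B⊆ x∈
  foldSum-mono (suc h) {A} {A′} {B} {B′} A⊆ B⊆ x∈ with ∈-⊕⁻ {A} x∈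
  ... | a , a∈ , y , y∈ , refl = ∈-⊕⁺ {A′} (A⊆ a∈) (foldSum-mono h {A} {A′} {B} {B′} A⊆ B⊆ y∈)

  foldSum-nonempty : ∀ h {A B} → Nonempty A → Nonempty B → Nonempty (foldSum h A B)
  foldSum-nonempty zero    _ ne = ne
  foldSum-nonempty (suc h) (a , a∈A) ne with y , y∈ ← foldSum-nonempty h (a , a∈A) ne =
    a + y , ∈-⊕⁺ a∈A y∈

  -- The sum of `h` Kneser inequalities, one for each added `A`. By `stab-⊕` stabilizers only grow
  -- along the chain, so a bound `S` for the last one bounds them all.
  kneser-foldSum : ∀ h {A B S} → Nonempty A → Nonempty B → stab (foldSum h A B) ⊆ S →
    h ℕ.* ∣ A ∣ ℕ.+ ∣ B ∣ ≤ ∣ foldSum h A B ∣ ℕ.+ h ℕ.* ∣ S ∣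
  kneser-foldSum zero    _ _ _ = ℕ.m≤m+n _ 0
  kneser-foldSum (suc h) {A} {B} {S} A≢∅ B≢∅ ⊆S = begin
    ∣ A ∣ ℕ.+ h ℕ.* ∣ A ∣ ℕ.+ ∣ B ∣        ≡⟨ ℕ.+-assoc ∣ A ∣ _ _ ⟩
    ∣ A ∣ ℕ.+ (h ℕ.* ∣ A ∣ ℕ.+ ∣ B ∣)      ≤⟨ ℕ.+-monoʳ-≤ ∣ A ∣ (kneser-foldSum h A≢∅ B≢∅ (⊆S ∘ stab-⊕ A T)) ⟩
    ∣ A ∣ ℕ.+ (∣ T ∣ ℕ.+ h ℕ.* ∣ S ∣)      ≡⟨ ℕ.+-assoc ∣ A ∣ _ _ ⟨
    ∣ A ∣ ℕ.+ ∣ T ∣ ℕ.+ h ℕ.* ∣ S ∣        ≤⟨ ℕ.+-monoˡ-≤ _ (kneser A T A≢∅ (foldSum-nonempty h A≢∅ B≢∅)) ⟩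
    ∣ A ⊕ T ∣ ℕ.+ ∣ stab (A ⊕ T) ∣ ℕ.+ h ℕ.* ∣ S ∣
                                           ≤⟨ ℕ.+-monoˡ-≤ _ (ℕ.+-monoʳ-≤ ∣ A ⊕ T ∣ (p⊆q⇒∣p∣≤∣q∣ ⊆S)) ⟩
    ∣ A ⊕ T ∣ ℕ.+ ∣ S ∣ ℕ.+ h ℕ.* ∣ S ∣    ≡⟨ ℕ.+-assoc ∣ A ⊕ T ∣ _ _ ⟩
    ∣ A ⊕ T ∣ ℕ.+ (∣ S ∣ ℕ.+ h ℕ.* ∣ S ∣)  ∎
    where
    open ℕ.≤-Reasoning
    T = foldSum h A B

  -- Every summand j A′ + S of h A has its stabilizer inside S = stab (h A). Starting the
  -- iteration at S rather than at 0 gains the extra ∣ S ∣ on the left.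
  kneser-⊛ : ∀ h A → Nonempty A → ∃[ S ] ∃[ A′ ] IsSubgroup S × S ⊆ stab A′ × A ⊆ A′ ×
             h ℕ.* ∣ A′ ∣ ℕ.+ ∣ S ∣ ≤ ∣ h ⊛ A ∣ ℕ.+ h ℕ.* ∣ S ∣
  kneser-⊛ h A (a , a∈A) = S , A′ , S-sub , stab-⊕ A S ∘ proj₂ S-sub , A⊆A′ ,
    subst (λ T → h ℕ.* ∣ A′ ∣ ℕ.+ ∣ S ∣ ≤ ∣ T ∣ ℕ.+ h ℕ.* ∣ S ∣) T≡hA
      (kneser-foldSum h {A′} {S} (a , A⊆A′ a∈A) (0# , proj₁ S-sub)
        (subst (λ T → stab T ⊆ S) (sym T≡hA) (λ x∈ → x∈)))
    where
    S A′ : Subset n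
    S  = stab (h ⊛ A)
    A′ = A ⊕ S

    S-sub : IsSubgroup S
    S-sub = stab-isSubgroup (h ⊛ A)

    A⊆A′ : A ⊆ A′
    A⊆A′ {x} x∈A = subst (_∈ A′) (identityʳ x) (∈-⊕⁺ {A} x∈A (proj₁ S-sub))

    foldSum⊆ : ∀ j → foldSum j A′ S ⊆ (j ⊛ A) ⊕ S
    foldSum⊆ zero {x} x∈S = subst (_∈ _) (identityˡ x) (∈-⊕⁺ {⁅ 0# ⁆} (x∈⁅x⁆ 0#) x∈S)
    foldSum⊆ (suc j) x∈ with ∈-⊕⁻ {A′} x∈
    ... | a′ , a′∈ , y , y∈ , refl with ∈-⊕⁻ {A} a′∈ | ∈-⊕⁻ {j ⊛ A} (foldSum⊆ j y∈)
    ... | a , a∈ , s , s∈ , refl | z , z∈ , t , t∈ , refl =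
      subst (_∈ (suc j ⊛ A) ⊕ S) (medial a z s t)
        (∈-⊕⁺ {suc j ⊛ A} (∈-⊕⁺ {A} a∈ z∈) (+-closed S-sub s∈ t∈))

    -- All copies of `S` collect into one, which `h ⊛ A` absorbs because `S` is its stabilizer; the
    -- other inclusion uses `0# ∈ S`.
    T≡hA : foldSum h A′ S ≡ h ⊛ A
    T≡hA = ⊆-antisym T⊆hA (foldSum-mono h {A} {A′} {⁅ 0# ⁆} {S} A⊆A′
      (λ x∈ → subst (_∈ S) (sym (x∈⁅y⁆⇒x≡y 0# x∈)) (proj₁ S-sub)))
      where
      T⊆hA : foldSum h A′ S ⊆ h ⊛ A
      T⊆hA x∈ with ∈-⊕⁻ {h ⊛ A} (foldSum⊆ h x∈)
      ... | y , y∈ , s , s∈ , refl = ∈-stab⁻ s∈ y∈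

  -- Cosets in arithmetic progression

  module _ {H : Subset n} (H-sub : IsSubgroup H) (v u : Fin n) where

    progression : ℕ → Subset n
    progression zero    = ⊥
    progression (suc N) = progression N ∪ coset H-sub (v + N ·ℕ u)

    ∈-progression⁺ : ∀ {N i x} → i < N → x − (v + i ·ℕ u) ∈ H → x ∈ progression N
    ∈-progression⁺ {suc N} {i} i<1+N x∈ with ℕ.m<1+n⇒m<n∨m≡n i<1+N
    ... | inj₁ i<N  = x∈p∪q⁺ (inj₁ (∈-progression⁺ i<N x∈))
    ... | inj₂ refl = x∈p∪q⁺ (inj₂ (∈-select⁺ (coset? H-sub _) x∈))

    ∈-progression⁻ : ∀ N {x} → x ∈ progression N → ∃[ i ] i < N × x − (v + i ·ℕ u) ∈ H
    ∈-progression⁻ zero    x∈ = contradiction x∈ ∉⊥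
    ∈-progression⁻ (suc N) x∈ with x∈p∪q⁻ (progression N) _ x∈
    ... | inj₁ x∈N with i , i<N , x∈H ← ∈-progression⁻ N x∈N = i , ℕ.m<n⇒m<1+n i<N , x∈H
    ... | inj₂ x∈c = N , ℕ.≤-refl , ∈-select⁻ (coset? H-sub _) x∈c

    ∣progression∣≤ : ∀ N → ∣ progression N ∣ ≤ N ℕ.* ∣ H ∣
    ∣progression∣≤ zero    = ℕ.≤-reflexive (∣⊥∣≡0 n)
    ∣progression∣≤ (suc N) = begin
      ∣ progression N ∪ coset H-sub (v + N ·ℕ u) ∣
        ≤⟨ ∣r∣≤∣p∣+∣q∣ {p = progression N} (x∈p∪q⁻ (progression N) _) ⟩
      ∣ progression N ∣ ℕ.+ ∣ coset H-sub (v + N ·ℕ u) ∣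
        ≤⟨ ℕ.+-mono-≤ (∣progression∣≤ N) (ℕ.≤-reflexive (∣coset∣≡∣H∣ H-sub _)) ⟩
      N ℕ.* ∣ H ∣ ℕ.+ ∣ H ∣
        ≡⟨ ℕ.+-comm _ ∣ H ∣ ⟩
      ∣ H ∣ ℕ.+ N ℕ.* ∣ H ∣ ∎
      where open ℕ.≤-Reasoning

    -- The coset with index `N` meets an earlier one with index `i` only if `(N ∸ i) ·ℕ u` lies in
    -- `H`, which `order` excludes.
    ≤∣progression∣ : ∀ N → (∀ {i} → 0 < i → i < N → i ·ℕ u ∉ H) →
                     N ℕ.* ∣ H ∣ ≤ ∣ progression N ∣
    ≤∣progression∣ zero    _     = z≤n
    ≤∣progression∣ (suc N) order = begin
      ∣ H ∣ ℕ.+ N ℕ.* ∣ H ∣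
        ≡⟨ ℕ.+-comm ∣ H ∣ _ ⟩
      N ℕ.* ∣ H ∣ ℕ.+ ∣ H ∣
        ≤⟨ ℕ.+-mono-≤ (≤∣progression∣ N (λ 0<i i<N → order 0<i (ℕ.m<n⇒m<1+n i<N)))
                      (ℕ.≤-reflexive (sym (∣coset∣≡∣H∣ H-sub _))) ⟩
      ∣ progression N ∣ ℕ.+ ∣ coset H-sub (v + N ·ℕ u) ∣
        ≤⟨ ∣p∣+∣q∣≤∣r∣ (p⊆p∪q _) (q⊆p∪q (progression N) _) disjoint ⟩
      ∣ progression (suc N) ∣ ∎
      where
      open ℕ.≤-Reasoning

      disjoint : ∀ {x} → x ∈ progression N → x ∉ coset H-sub (v + N ·ℕ u)
      disjoint {x} x∈N x∈c with i , i<N , x∈H ← ∈-progression⁻ N x∈N =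
        order (ℕ.m<n⇒0<n∸m i<N) (s≤s (ℕ.m∸n≤m N i))
          (stab-reflects (proj₂ H-sub (∈-select⁻ (coset? H-sub _) x∈c))
            (subst (_∈ H) (sym (shift-by x split)) x∈H))
        where
        split : v + N ·ℕ u ≡ v + i ·ℕ u + (N ℕ.∸ i) ·ℕ u
        split = trans (cong (λ k → v + k ·ℕ u) (sym (ℕ.m+[n∸m]≡n (ℕ.<⇒≤ i<N))))
          (trans (cong (v +_) (×-homo-+ u i (N ℕ.∸ i))) (sym (assoc v _ _)))

        shift-by : ∀ x {z z′ w} → z′ ≡ z + w → w + (x − z′) ≡ x − z
        shift-by x {z} {_} {w} refl = ∙-cancelʳ (z + w) _ _ (trans (assoc w _ _)
          (trans (cong (w +_) (x−y+y≡x (z + w) x)) (trans (comm w x)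
            (sym (trans (sym (assoc (x − z) z w)) (cong (_+ w) (x−y+y≡x z x)))))))

    -- Negation exchanges the cosets with indices `i` and `b ∸ i`, whose representatives add up to
    -- `v + v + b ·ℕ u = 0#`.
    progression-symmetric : ∀ b → v + (v + b ·ℕ u) ≡ 0# →
                            ∀ {x} → x ∈ progression (suc b) → - x ∈ progression (suc b)
    progression-symmetric b centred {x} x∈ with i , s≤s i≤b , x∈H ← ∈-progression⁻ (suc b) x∈ =
      ∈-progression⁺ {i = b ℕ.∸ i} (s≤s (ℕ.m∸n≤m b i)) (subst (_∈ H) eq (-‿closed H-sub x∈H))
      where
      open ≡-Reasoning

      reflected : v + i ·ℕ u + (v + (b ℕ.∸ i) ·ℕ u) ≡ 0#
      reflected = begin
        v + i ·ℕ u + (v + (b ℕ.∸ i) ·ℕ u)     ≡⟨ medial v _ v _ ⟩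
        v + v + (i ·ℕ u + (b ℕ.∸ i) ·ℕ u)     ≡⟨ cong (v + v +_) (×-homo-+ u i (b ℕ.∸ i)) ⟨
        v + v + (i ℕ.+ (b ℕ.∸ i)) ·ℕ u        ≡⟨ cong (λ k → v + v + k ·ℕ u) (ℕ.m+[n∸m]≡n i≤b) ⟩
        v + v + b ·ℕ u                        ≡⟨ assoc v v _ ⟩
        v + (v + b ·ℕ u)                      ≡⟨ centred ⟩
        0#                                    ∎

      eq : - (x − (v + i ·ℕ u)) ≡ - x − (v + (b ℕ.∸ i) ·ℕ u)
      eq = begin
        - (x − (v + i ·ℕ u))             ≡⟨ ⁻¹-∙-comm x _ ⟨
        - x − (- (v + i ·ℕ u))           ≡⟨ cong (λ z → - x − (- z)) (inverseˡ-unique _ _ reflected) ⟩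
        - x − (- (- (v + (b ℕ.∸ i) ·ℕ u))) ≡⟨ cong (- x +_) (⁻¹-involutive _) ⟩
        - x − (v + (b ℕ.∸ i) ·ℕ u)       ∎

  -- Indices add, so `h` indices from `0` to `b` give one from `0` to `h * b`: few cosets, because
  -- all share the difference `u`.
  ⊛-progression : ∀ {H} (H-sub : IsSubgroup H) v u b h →
    h ⊛ progression H-sub v u (suc b) ⊆ progression H-sub (h ·ℕ v) u (suc (h ℕ.* b))
  ⊛-progression {H} H-sub v u b zero x∈ = ∈-progression⁺ H-sub 0# u {1} {0} (s≤s z≤n)
    (subst (_∈ H) (sym eq) (proj₁ H-sub))
    where
    eq : _ − (0# + 0#) ≡ 0#
    eq = trans (cong (_− (0# + 0#)) (trans (x∈⁅y⁆⇒x≡y 0# x∈) (sym (identityˡ 0#)))) (inverseʳ _)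
  ⊛-progression {H} H-sub v u b (suc h) x∈ with ∈-⊕⁻ {progression H-sub v u (suc b)} x∈
  ... | c , c∈ , y , y∈ , refl
    with i , s≤s i≤b , c∈H ← ∈-progression⁻ H-sub v u (suc b) c∈
       | j , s≤s j≤hb , y∈H ← ∈-progression⁻ H-sub (h ·ℕ v) u (suc (h ℕ.* b)) (⊛-progression H-sub v u b h y∈)
    = ∈-progression⁺ H-sub (suc h ·ℕ v) u {i = i ℕ.+ j} (s≤s (ℕ.+-mono-≤ i≤b j≤hb))
        (subst (_∈ H) eq (+-closed H-sub c∈H y∈H))
    where
    open ≡-Reasoning

    eq : (c − (v + i ·ℕ u)) + (y − (h ·ℕ v + j ·ℕ u)) ≡ c + y − (suc h ·ℕ v + (i ℕ.+ j) ·ℕ u)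
    eq = begin
      (c − (v + i ·ℕ u)) + (y − (h ·ℕ v + j ·ℕ u))        ≡⟨ medial c _ y _ ⟩
      c + y + (- (v + i ·ℕ u) − (h ·ℕ v + j ·ℕ u))        ≡⟨ cong (c + y +_) (⁻¹-∙-comm _ _) ⟩
      c + y − (v + i ·ℕ u + (h ·ℕ v + j ·ℕ u))            ≡⟨ cong (c + y −_) (medial v _ _ _) ⟩
      c + y − (suc h ·ℕ v + (i ·ℕ u + j ·ℕ u))            ≡⟨ cong (λ z → c + y − (suc h ·ℕ v + z)) (×-homo-+ u i j) ⟨
      c + y − (suc h ·ℕ v + (i ℕ.+ j) ·ℕ u)               ∎

  -- Linear combinations

  ⊛-+ : ∀ h k {A x y} → x ∈ h ⊛ A → y ∈ k ⊛ A → x + y ∈ (h ℕ.+ k) ⊛ A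
  ⊛-+ zero    k {A} {x} {y} x∈ y∈ =
    subst (_∈ k ⊛ A) (sym (trans (cong (_+ y) (x∈⁅y⁆⇒x≡y 0# x∈)) (identityˡ y))) y∈
  ⊛-+ (suc h) k {A} {x} {y} x∈ y∈ with ∈-⊕⁻ {A} x∈
  ... | a , a∈ , z , z∈ , refl =
    subst (_∈ (suc h ℕ.+ k) ⊛ A) (sym (assoc a z y)) (∈-⊕⁺ {A} a∈ (⊛-+ h k z∈ y∈))

  ·ℕ-∈-⊛ : ∀ k {A a} → a ∈ A → k ·ℕ a ∈ k ⊛ A
  ·ℕ-∈-⊛ zero    a∈ = x∈⁅x⁆ 0#
  ·ℕ-∈-⊛ (suc k) {A} a∈ = ∈-⊕⁺ {A} a∈ (·ℕ-∈-⊛ k a∈)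

  module _ {C : Subset n} (symmetric : ∀ {x} → x ∈ C → - x ∈ C) where

    -‿·ℕ : ∀ k a → - (k ·ℕ a) ≡ k ·ℕ (- a)
    -‿·ℕ zero    a = ε⁻¹≈ε
    -‿·ℕ (suc k) a = trans (sym (⁻¹-∙-comm a _)) (cong (- a +_) (-‿·ℕ k a))

    -- A negative multiple of `a` is a positive multiple of `- a`, which is also in `C`; hence only
    -- the absolute value of the coefficient counts.
    ·ℤ-∈-⊛ : ∀ z {a} → a ∈ C → z ·ℤ a ∈ ℤ.∣ z ∣ ⊛ C
    ·ℤ-∈-⊛ (ℤ.+ k)      a∈ = ·ℕ-∈-⊛ k a∈
    ·ℤ-∈-⊛ -[1+ k ] {a} a∈ =
      subst (_∈ suc k ⊛ C) (sym (-‿·ℕ (suc k) a)) (·ℕ-∈-⊛ (suc k) (symmetric a∈))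

    signedSum∈⊛ : ∀ {m} (c : Vector ℤ m) {a : Vector (Fin n) m} → (∀ i → a i ∈ C) →
      ∑ (λ i → c i ·ℤ a i) ∈ sum +-0-rawMonoid (λ i → ℤ.∣ c i ∣) ⊛ C
    signedSum∈⊛ {zero}  c a∈ = x∈⁅x⁆ 0#
    signedSum∈⊛ {suc m} c a∈ = ⊛-+ ℤ.∣ c zero ∣ _ (·ℤ-∈-⊛ (c zero) (a∈ zero)) (signedSum∈⊛ (c ∘ suc) (a∈ ∘ suc))

    signedSumset⊆⊛ : ∀ h {B} → B ⊆ C → signedSumset G h B ⊆ h ⊛ C
    signedSumset⊆⊛ h {B} B⊆C x∈
      with c , refl , refl ← ∈-select⁻ (isSignedSum? G h (lookup (elements B))) x∈ =
      signedSum∈⊛ c (λ i → B⊆C (proj₂ (∈-filter⁻ (_∈? B) {xs = allFin n} (∈-lookup i))))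

  isSum-0 : ∀ {m} (a : Vector (Fin n) m) → IsSum G 0 a 0#
  isSum-0 {zero}  a = (λ ()) , refl , refl
  isSum-0 {suc m} a with c , c≡0 , ca≡0 ← isSum-0 (a ∘ suc) =
    (0 Vector.∷ c) , c≡0 , trans (identityˡ _) ca≡0

  isSum-suc : ∀ {h m} (a : Vector (Fin n) m) i {x} → IsSum G h a x → IsSum G (suc h) a (a i + x)
  isSum-suc a zero (c , refl , refl) =
    (suc (c zero) Vector.∷ (c ∘ suc)) , refl , assoc (a zero) _ _
  isSum-suc a (suc i) (c , refl , refl)
    with c′ , c′≡ , c′a≡ ← isSum-suc (a ∘ suc) i (c ∘ suc , refl , refl) =
    (c zero Vector.∷ c′) , trans (cong (c zero ℕ.+_) c′≡) (ℕ.+-suc (c zero) _) ,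
    trans (cong (c zero ·ℕ a zero +_) c′a≡) (swapˡ (c zero ·ℕ a zero) (a (suc i)) _)

  ⊛⊆sumset : ∀ h A → h ⊛ A ⊆ sumset G h A
  ⊛⊆sumset h A = ∈-select⁺ (isSum? G h (lookup (elements A))) ∘ go h
    where
    go : ∀ h {x} → x ∈ h ⊛ A → IsSum G h (lookup (elements A)) x
    go zero    x∈ = subst (IsSum G 0 _) (sym (x∈⁅y⁆⇒x≡y 0# x∈)) (isSum-0 (lookup (elements A)))
    go (suc h) x∈ with ∈-⊕⁻ {A} x∈
    ... | a , a∈ , y , y∈ , refl =
      let a∈els = ∈-filter⁺ (_∈? A) (∈-allFin a) a∈ in
      subst (λ z → IsSum G (suc h) (lookup (elements A)) (z + y)) (sym (lookup-index a∈els))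
        (isSum-suc (lookup (elements A)) (index a∈els) (go h y∈))

  sumset⊆signedSumset : ∀ h A → sumset G h A ⊆ signedSumset G h A
  sumset⊆signedSumset h A x∈ with c , c≡h , ca≡x ← ∈-select⁻ (isSum? G h (lookup (elements A))) x∈ =
    ∈-select⁺ (isSignedSum? G h (lookup (elements A))) (ℤ.+_ ∘ c , c≡h , ca≡x)

  -- Lower bound for sumsets and symmetric sets attaining it

  nonempty⇒sumset-bound : ∀ h A → Nonempty A → ∃[ b ] ∃[ k ] ∃[ d ]
    n ≡ k ℕ.* d × b < k × ∣ A ∣ ≤ suc b ℕ.* d × suc (h ℕ.* b) ℕ.* d ≤ ∣ sumset G h A ∣
  nonempty⇒sumset-bound h A (a , a∈A)
    with S , A′ , S-sub , S⊆ , A⊆A′ , bound ← kneser-⊛ h A (a , a∈A)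
    with lagrange S-sub S⊆
       | lagrange S-sub {⊤} (λ _ → ∈-stab⁺ {⊤} (λ _ → ∈⊤))
  ... | divides zero ∣A′∣≡0 | _ =
    contradiction (ℕ.≤-trans (s≤s z≤n) (x∈p⇒∣p-x∣<∣p∣ (A⊆A′ a∈A))) (ℕ.≤⇒≯ (ℕ.≤-reflexive ∣A′∣≡0))
  -- `suc b` is the number of cosets of `S` in `A′`, and `k` is the index of `S`. The Kneser bound
  -- becomes `h(b+1)d + d ≤ |hA| + hd`, from which `hd` is cancelled.
  ... | divides (suc b) ∣A′∣≡ | divides k n≡ = b , k , d , n≡kd , b<k ,
    subst (∣ A ∣ ≤_) ∣A′∣≡ (p⊆q⇒∣p∣≤∣q∣ A⊆A′) ,
    ℕ.+-cancelʳ-≤ (h ℕ.* d) _ _ (begin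
      suc (h ℕ.* b) ℕ.* d ℕ.+ h ℕ.* d           ≡⟨ rearrange h b d ⟩
      h ℕ.* (suc b ℕ.* d) ℕ.+ d                 ≡⟨ cong (λ z → h ℕ.* z ℕ.+ d) ∣A′∣≡ ⟨
      h ℕ.* ∣ A′ ∣ ℕ.+ d                        ≤⟨ bound ⟩
      ∣ h ⊛ A ∣ ℕ.+ h ℕ.* d                     ≤⟨ ℕ.+-monoˡ-≤ (h ℕ.* d) (p⊆q⇒∣p∣≤∣q∣ (⊛⊆sumset h A)) ⟩
      ∣ sumset G h A ∣ ℕ.+ h ℕ.* d         ∎)
    where
    open ℕ.≤-Reasoning

    d : ℕ
    d = ∣ S ∣

    n≡kd : n ≡ k ℕ.* d
    n≡kd = trans (sym (∣⊤∣≡n n)) n≡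

    b<k : b < k
    b<k = ℕ.*-cancelʳ-≤ (suc b) k d
      {{ℕ.>-nonZero (ℕ.≤-trans (s≤s z≤n) (x∈p⇒∣p-x∣<∣p∣ (proj₁ S-sub)))}}
      (subst₂ _≤_ ∣A′∣≡ n≡kd (∣p∣≤n A′))

    rearrange : ∀ h b d → suc (h ℕ.* b) ℕ.* d ℕ.+ h ℕ.* d ≡ h ℕ.* (suc b ℕ.* d) ℕ.+ d
    rearrange = solve-∀

  -- Any `m` elements of the progression serve: `order` makes its `suc b` cosets distinct, leaving
  -- enough room, and `centred` makes it symmetric, so signed sums of its elements are plain
  -- `h`-fold sums in it.
  symmetric-witness : ∀ {H} (H-sub : IsSubgroup H) v u b → v + (v + b ·ℕ u) ≡ 0# →
    (∀ {i} → 0 < i → i < suc b → i ·ℕ u ∉ H) → ∀ {m} → m ≤ suc b ℕ.* ∣ H ∣ → ∀ h →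
    ∃[ B ] ∣ B ∣ ≡ m × ∣ signedSumset G h B ∣ ≤ suc (h ℕ.* b) ℕ.* ∣ H ∣
  symmetric-witness H-sub v u b centred order m≤ h
    with B , B⊆C , ∣B∣≡m ← subsetOf (progression H-sub v u (suc b))
      (ℕ.≤-trans m≤ (≤∣progression∣ H-sub v u (suc b) order)) =
    B , ∣B∣≡m , ℕ.≤-trans
      (p⊆q⇒∣p∣≤∣q∣ (⊛-progression H-sub v u b h
        ∘ signedSumset⊆⊛ (progression-symmetric H-sub v u b centred) h B⊆C))
      (∣progression∣≤ H-sub (h ·ℕ v) u (suc (h ℕ.* b)))

-- Cyclic groups

halve : ∀ n → ∃[ m ] (n ≡ m ℕ.+ m ⊎ n ≡ suc (m ℕ.+ m))
halve zero = 0 , inj₁ refl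
halve (suc n) with halve n
... | m , inj₁ refl = m , inj₂ refl
... | m , inj₂ refl = suc m , inj₁ (cong suc (sym (ℕ.+-suc m m)))

-- With `k = 2q + 1`, the multiple `k * i` equals `q * (i + i) + i`.
odd∣i+i⇒∣i : ∀ q {i} → suc (q ℕ.+ q) ∣ i ℕ.+ i → suc (q ℕ.+ q) ∣ i
odd∣i+i⇒∣i q {i} k∣2i = ∣m+n∣m⇒∣n (subst (suc (q ℕ.+ q) ∣_) (eq q i) (m∣m*n i)) (∣n⇒∣m*n q k∣2i)
  where
  eq : ∀ q i → suc (q ℕ.+ q) ℕ.* i ≡ q ℕ.* (i ℕ.+ i) ℕ.+ i
  eq = solve-∀

module _ (n : ℕ) .{{_ : NonZero n}} where

  open FiniteAbelianGroup (ℤ/ n)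
  open AbelianGroup abelianGroup using (commutativeMonoid; monoid; assoc; identityˡ; inverseˡ)
    renaming (_-_ to _−_)
  open AbelianGroupProperties abelianGroup using () renaming (//-rightDividesʳ to x+y−y≡x)
  open CommutativeMonoidMult commutativeMonoid using (×-distrib-+)
  open MonoidMult monoid using (×-homo-+)

  private
    1# : Fin n
    1# = 1 mod n

  toℕ-·ℕ-1# : ∀ k → toℕ (k ·ℕ 1#) ≡ k % n
  toℕ-·ℕ-1# zero    = toℕ-fromℕ< (m%n<n 0 n)
  toℕ-·ℕ-1# (suc k) = begin
    toℕ (1# + k ·ℕ 1#)                ≡⟨ toℕ-fromℕ< (m%n<n _ n) ⟩
    (toℕ 1# ℕ.+ toℕ (k ·ℕ 1#)) % n    ≡⟨ cong₂ (λ i j → (i ℕ.+ j) % n) (toℕ-fromℕ< (m%n<n 1 n)) (toℕ-·ℕ-1# k) ⟩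
    (1 % n ℕ.+ k % n) % n             ≡⟨ %-distribˡ-+ 1 k n ⟨
    suc k % n                         ∎
    where open ≡-Reasoning

  toℕ-·ℕ-1#-inverse : ∀ x → toℕ x ·ℕ 1# ≡ x
  toℕ-·ℕ-1#-inverse x = toℕ-injective (trans (toℕ-·ℕ-1# (toℕ x)) (m<n⇒m%n≡m (toℕ<n x)))

  module _ {k : ℕ} (k∣n : k ∣ n) where

    multiple? : Decidable (λ (x : Fin n) → k ∣ toℕ x)
    multiple? x = k ∣? toℕ x

    multiples : Subset n
    multiples = select multiple?

    ·ℕ-1#∈multiples⁺ : ∀ {j} → k ∣ j → j ·ℕ 1# ∈ multiples
    ·ℕ-1#∈multiples⁺ {j} k∣j = ∈-select⁺ multiple?
      (subst (k ∣_) (sym (toℕ-·ℕ-1# j)) (%-presˡ-∣ k∣j k∣n))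

    ·ℕ-1#∈multiples⁻ : ∀ {j} → j ·ℕ 1# ∈ multiples → k ∣ j
    ·ℕ-1#∈multiples⁻ {j} j∈ = ∣n∣m%n⇒∣m k∣n
      (subst (k ∣_) (toℕ-·ℕ-1# j) (∈-select⁻ multiple? j∈))

    multiples-isSubgroup : IsSubgroup (ℤ/ n) multiples
    multiples-isSubgroup = ·ℕ-1#∈multiples⁺ {0} (k ∣0) , λ {y} y∈ → ∈-stab⁺ (ℤ/ n) λ {x} x∈ →
      ∈-select⁺ multiple? (subst (k ∣_) (sym (toℕ-fromℕ< (m%n<n _ n)))
        (%-presˡ-∣ (∣m∣n⇒∣m+n (∈-select⁻ multiple? x∈) (∈-select⁻ multiple? y∈)) k∣n))

    order-1# : ∀ {i} → 0 < i → i < k → i ·ℕ 1# ∉ multiples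
    order-1# {i} 0<i i<k i∈ = >⇒∤ {{ℕ.>-nonZero 0<i}} i<k (·ℕ-1#∈multiples⁻ {i} i∈)

    -- The cosets of `0#`, `1#`, up to `k - 1` times `1#`, are distinct by `order-1#` and exhaust
    -- the group, as `toℕ x % k` names the one containing `x`. So `k` times the size is `n`.
    ∣multiples∣ : ∀ {d} → n ≡ k ℕ.* d → ∣ multiples ∣ ≡ d
    ∣multiples∣ {d} n≡kd = ℕ.*-cancelˡ-≡ _ d k (trans (ℕ.≤-antisym
      (ℕ.≤-trans (≤∣progression∣ (ℤ/ n) multiples-isSubgroup 0# 1# k order-1#)
        (∣p∣≤n (progression (ℤ/ n) multiples-isSubgroup 0# 1# k)))
      (subst (_≤ k ℕ.* ∣ multiples ∣) (∣⊤∣≡n n) (ℕ.≤-trans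
        (p⊆q⇒∣p∣≤∣q∣ {p = ⊤} (λ {x} _ → ∈-progression⁺ (ℤ/ n) multiples-isSubgroup 0# 1#
          (m%n<n (toℕ x) k) (subst (_∈ multiples) (sym (eq x)) (·ℕ-1#∈multiples⁺ (n∣m*n (toℕ x / k))))))
        (∣progression∣≤ (ℤ/ n) multiples-isSubgroup 0# 1# k)))) n≡kd)
      where
      instance
        k≢0 : NonZero k
        k≢0 = ℕ.m*n≢0⇒m≢0 k {{subst NonZero n≡kd it}}

      eq : ∀ x → x − (0# + (toℕ x % k) ·ℕ 1#) ≡ (toℕ x / k ℕ.* k) ·ℕ 1#
      eq x = begin
        x − (0# + r)              ≡⟨ cong₂ _−_ x≡q+r (identityˡ r) ⟩
        q + r − r                 ≡⟨ x+y−y≡x r q ⟩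
        q                         ∎
        where
        open ≡-Reasoning
        r q : Fin n
        r = (toℕ x % k) ·ℕ 1#
        q = (toℕ x / k ℕ.* k) ·ℕ 1#

        x≡q+r : x ≡ q + r
        x≡q+r = begin
          x                                               ≡⟨ toℕ-·ℕ-1#-inverse x ⟨
          toℕ x ·ℕ 1#                                     ≡⟨ cong (_·ℕ 1#) (m≡m%n+[m/n]*n (toℕ x) k) ⟩
          (toℕ x % k ℕ.+ toℕ x / k ℕ.* k) ·ℕ 1#           ≡⟨ cong (_·ℕ 1#) (ℕ.+-comm (toℕ x % k) _) ⟩
          (toℕ x / k ℕ.* k ℕ.+ toℕ x % k) ·ℕ 1#           ≡⟨ ×-homo-+ 1# (toℕ x / k ℕ.* k) _ ⟩
          q + r                                           ∎

  -t−t+2t≡0 : ∀ t → - t + (- t + (t + t)) ≡ 0#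
  -t−t+2t≡0 t = begin
    - t + (- t + (t + t))   ≡⟨ assoc (- t) (- t) _ ⟨
    - t + - t + (t + t)     ≡⟨ medial (ℤ/ n) (- t) (- t) t t ⟩
    - t + t + (- t + t)     ≡⟨ cong₂ _+_ (inverseˡ t) (inverseˡ t) ⟩
    0# + 0#                 ≡⟨ identityˡ 0# ⟩
    0#                      ∎
    where open ≡-Reasoning

  HasSmallSignedSumset : ℕ → ℕ → ℕ → Set
  HasSmallSignedSumset m h s = ∃[ B ] ∣ B ∣ ≡ m × ∣ signedSumset (ℤ/ n) h B ∣ ≤ s

  -- Half of `b ·ℕ u` being `t`, a progression that starts at `- t` is centred. The condition on `j`
  -- keeps its cosets distinct, since `j ·ℕ 1#` lies in the subgroup only when `k` divides `j`.
  smallSignedSumset-step : ∀ {m} h b {k d} → n ≡ k ℕ.* d → m ≤ suc b ℕ.* d →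
    ∀ u t → b ·ℕ u ≡ t + t → (∀ {i} → 0 < i → i ≤ b → ∃[ j ] i ·ℕ u ≡ j ·ℕ 1# × ¬ (k ∣ j)) →
    HasSmallSignedSumset m h (suc (h ℕ.* b) ℕ.* d)
  smallSignedSumset-step {m} h b {k} {d} n≡kd m≤ u t bu≡2t order =
    subst (λ s → HasSmallSignedSumset m h (suc (h ℕ.* b) ℕ.* s)) ∣H∣≡d
      (symmetric-witness (ℤ/ n) (multiples-isSubgroup k∣n) (- t) u b
        (trans (cong (λ z → - t + (- t + z)) bu≡2t) (-t−t+2t≡0 t))
        (λ 0<i i<1+b iu∈H → let j , iu≡j1 , k∤j = order 0<i (ℕ.≤-pred i<1+b) in
          k∤j (·ℕ-1#∈multiples⁻ k∣n {j} (subst (_∈ multiples k∣n) iu≡j1 iu∈H)))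
        (subst (λ s → m ≤ suc b ℕ.* s) (sym ∣H∣≡d) m≤) h)
    where
    k∣n : k ∣ n
    k∣n = divides d (trans n≡kd (ℕ.*-comm k d))

    ∣H∣≡d : ∣ multiples k∣n ∣ ≡ d
    ∣H∣≡d = ∣multiples∣ k∣n n≡kd

  smallSignedSumset : ∀ h .{{_ : NonZero h}} b {k d m} → n ≡ k ℕ.* d → b < k → m ≤ suc b ℕ.* d →
                      HasSmallSignedSumset m h (suc (h ℕ.* b) ℕ.* d)
  smallSignedSumset h = <-rec _ go
    where
    go : ∀ b → (∀ {c} → c < b → ∀ {k d m} → n ≡ k ℕ.* d → c < k → m ≤ suc c ℕ.* d →
           HasSmallSignedSumset m h (suc (h ℕ.* c) ℕ.* d)) →
         ∀ {k d m} → n ≡ k ℕ.* d → b < k → m ≤ suc b ℕ.* d →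
         HasSmallSignedSumset m h (suc (h ℕ.* b) ℕ.* d)
    go b rec {k} {d} {m} n≡kd b<k m≤ with halve b | halve k
    -- `b = 2c` is even: difference one, and half of `b ·ℕ 1#` is `c ·ℕ 1#`.
    ... | c , inj₁ refl | _ =
      smallSignedSumset-step h b n≡kd m≤ 1# (c ·ℕ 1#) (×-homo-+ 1# c c)
        (λ {i} 0<i i≤b → i , refl , >⇒∤ {{ℕ.>-nonZero 0<i}} (ℕ.≤-<-trans i≤b b<k))
    -- `k` is odd: difference two, so that the half exists for every `b`. Were `k` to divide
    -- `i + i`, it would divide `i`, but `0 < i < k`.
    ... | _ | q , inj₂ refl =
      smallSignedSumset-step h b n≡kd m≤ (1# + 1#) (b ·ℕ 1#) (×-distrib-+ 1# 1# b)
        (λ {i} 0<i i≤b → i ℕ.+ i , trans (×-distrib-+ 1# 1# i) (sym (×-homo-+ 1# i i)) ,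
          >⇒∤ {{ℕ.>-nonZero 0<i}} (ℕ.≤-<-trans i≤b b<k) ∘ odd∣i+i⇒∣i q)
    -- `b = 2c + 1` and `k = 2q`: pass to the subgroup of twice the order, where `c + 1` cosets hold
    -- as much as `b + 1` did.
    ... | c , inj₂ refl | q , inj₁ refl =
      let B , ∣B∣≡m , small = rec (s≤s (ℕ.m≤m+n c c)) {q} {d ℕ.+ d} {m}
            (trans n≡kd (double q d)) c<q (ℕ.≤-trans m≤ (ℕ.≤-reflexive (double′ c d)))
      in B , ∣B∣≡m , ℕ.≤-trans small (begin
        suc (h ℕ.* c) ℕ.* (d ℕ.+ d)               ≡⟨ double″ h c d ⟩
        -- This is where `h` must be positive: `2hc + 2` is at most `2hc + h + 1`, which is
        -- `hb + 1`.
        (1 ℕ.+ (1 ℕ.+ h ℕ.* (c ℕ.+ c))) ℕ.* d     ≤⟨ ℕ.*-monoˡ-≤ d (s≤s (ℕ.+-monoˡ-≤ _ (ℕ.>-nonZero⁻¹ h))) ⟩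
        (1 ℕ.+ (h ℕ.+ h ℕ.* (c ℕ.+ c))) ℕ.* d     ≡⟨ cong (λ z → suc z ℕ.* d) (ℕ.*-suc h (c ℕ.+ c)) ⟨
        suc (h ℕ.* suc (c ℕ.+ c)) ℕ.* d           ∎)
      where
      open ℕ.≤-Reasoning

      c<q : c < q
      c<q = ℕ.≰⇒> λ q≤c → ℕ.<⇒≱ b<k (ℕ.m≤n⇒m≤1+n (ℕ.+-mono-≤ q≤c q≤c))

      double : ∀ q d → (q ℕ.+ q) ℕ.* d ≡ q ℕ.* (d ℕ.+ d)
      double = solve-∀

      double′ : ∀ c d → suc (suc (c ℕ.+ c)) ℕ.* d ≡ suc c ℕ.* (d ℕ.+ d)
      double′ = solve-∀

      double″ : ∀ h c d → suc (h ℕ.* c) ℕ.* (d ℕ.+ d) ≡ (1 ℕ.+ (1 ℕ.+ h ℕ.* (c ℕ.+ c))) ℕ.* d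
      double″ = solve-∀

-- Comparison of the two minima

minimum-mono : ∀ {m n} (m≤n : m ≤ n) {f g : Subset n → ℕ} →
  (∀ B → ∣ B ∣ ≡ m → ∃[ A ] ∣ A ∣ ≡ m × f A ≤ g B) →
  proj₁ (minimumOverSubsets m≤n f) ≤ proj₁ (minimumOverSubsets m≤n g)
minimum-mono m≤n {f} {g} f≼g
  with minimumOverSubsets m≤n f | minimumOverSubsets m≤n g
... | _ , _ , f-min | _ , (B , ∣B∣≡m , refl) , _
  with A , ∣A∣≡m , fA≤gB ← f≼g B ∣B∣≡m = ℕ.≤-trans (f-min A ∣A∣≡m) fA≤gB

theorem4 : ∀ (n m h : ℕ) .{{_ : NonZero n}} .{{_ : NonZero m}} .{{_ : NonZero h}} → (m≤n : m ≤ n) → ρ± (ℤ/ n) m h m≤n ≡ ρ (ℤ/ n) m h m≤n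
theorem4 n m h m≤n = ℕ.≤-antisym
  (minimum-mono m≤n λ A ∣A∣≡m →
    -- Only the parameters `b`, `k`, `d` pass from `A` to the new set `B`, which may be unrelated to
    -- `A`; both estimates meet at `(hb + 1)d`.
    let b , k , d , n≡kd , b<k , ∣A∣≤ , bound = nonempty⇒sumset-bound (ℤ/ n) h A (nonempty A ∣A∣≡m)
        B , ∣B∣≡m , small = smallSignedSumset n h b n≡kd b<k (subst (_≤ suc b ℕ.* d) ∣A∣≡m ∣A∣≤)
    in B , ∣B∣≡m , ℕ.≤-trans small bound)
  (minimum-mono m≤n λ A ∣A∣≡m → A , ∣A∣≡m , p⊆q⇒∣p∣≤∣q∣ (sumset⊆signedSumset (ℤ/ n) h A))
  where
  nonempty : ∀ (A : Subset n) → ∣ A ∣ ≡ m → Nonempty A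
  nonempty A ∣A∣≡m = decidable-stable (nonempty? A) λ empty → ℕ.≢-nonZero⁻¹ m
    (trans (sym ∣A∣≡m) (trans (cong ∣_∣ (Empty-unique empty)) (∣⊥∣≡0 n)))
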